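{- For every integer $k\ge 4$, $$M(2k-1,3)\ge \frac{k+1}{2}-\max_{t\in\{1,\dots,k-2\}}\min\left(\frac{t}{k-2},\ \frac{(k+1)/2-(t-1)^2}{2k-3}\right).$$
   Context: The 2-density of a graph $H$ is $m_2(H)=\max\{\frac{e(H')-1}{|H'|-2}: H'\subseteq H,\ |H'|\ge 3\}$. $M(m,r)$ is the minimum of $m_2(H)$ over all graphs $H$ on $m$ vertices with independence number $\alpha(H)\le r-1$. -}

module Defs where

open import Data.Nat as ℕ using (ℕ; zero; suc; _∸_; _<ᵇ_)
open import Data.Integer as ℤ using (ℤ; +_)
open import Data.Rational as ℚ using (ℚ; _/_; _-_; _*_; _⊔_; _⊓_; _≤_)
open import Data.Bool using (Bool; true; false; if_then_else_; _∧_)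
open import Data.Fin using (Fin; toℕ)
open import Data.Fin.Subset using (Subset; _∈_; ∣_∣)
open import Data.List using (List; map; allFin)
open import Data.Nat.ListAction using (sum)
open import Data.Product using (Σ; _×_; ∃)
open import Relation.Binary.PropositionalEquality using (_≡_; _≢_)

record Graph (n : ℕ) : Set where
  field
    adj   : Fin n → Fin n → Bool
    sym   : ∀ i j → adj i j ≡ adj j i
    irrefl : ∀ i → adj i i ≡ false
open Graph public

pairCount : {n : ℕ} → (Fin n → Fin n → Bool) → ℕ
pairCount {n} E =
  sum (map (λ i → sum (map (λ j → if (toℕ i <ᵇ toℕ j) ∧ E i j then 1 else 0)
                           (allFin n)))
           (allFin n))

edges : {n : ℕ} → Graph n → ℕ
edges H = pairCount (adj H)

Independent : {n : ℕ} → Graph n → Subset n → Set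
Independent H S = ∀ i j → i ∈ S → j ∈ S → adj H i j ≡ false

IndepNumberAtMost : {n : ℕ} → Graph n → ℕ → Set
IndepNumberAtMost {n} H s = (S : Subset n) → Independent H S → ∣ S ∣ ℕ.≤ s

record Subgraph {n : ℕ} (H : Graph n) : Set where
  field
    verts   : Subset n
    sedge   : Fin n → Fin n → Bool
    ssym    : ∀ i j → sedge i j ≡ sedge j i
    sub     : ∀ i j → sedge i j ≡ true → adj H i j ≡ true
    inVerts : ∀ i j → sedge i j ≡ true → i ∈ verts × j ∈ verts
open Subgraph public

-- a / d as a rational (d = 0 gives 0; only ever used with d ≥ 1).
ratio : ℤ → ℕ → ℚ
ratio a zero = ℚ.0ℚ
ratio a (suc d) = a / suc d

density2 : {n : ℕ} {H : Graph n} → Subgraph H → ℚ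
density2 H' = ratio (+ pairCount (sedge H') ℤ.- + 1) (∣ verts H' ∣ ∸ 2)

IsM2 : {n : ℕ} → Graph n → ℚ → Set
IsM2 H q =
  Σ (Subgraph H) (λ H' → (3 ℕ.≤ ∣ verts H' ∣) × (density2 H' ≡ q))
  × ((H' : Subgraph H) → 3 ℕ.≤ ∣ verts H' ∣ → density2 H' ≤ q)

IsM : ℕ → ℕ → ℚ → Set
IsM m r q =
  Σ (Graph m) (λ H → IndepNumberAtMost H (r ∸ 1) × IsM2 H q)
  × ((H : Graph m) → IndepNumberAtMost H (r ∸ 1) →
       (q' : ℚ) → IsM2 H q' → q ≤ q')

-- max_{t ∈ {1,…,n}} f t   (n ≥ 1; value 0 for n = 0, never used)
maxOver : (ℕ → ℚ) → ℕ → ℚ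
maxOver f zero = ℚ.0ℚ
maxOver f (suc zero) = f 1
maxOver f (suc (suc n)) = maxOver f (suc n) ⊔ f (suc (suc n))

bound : ℕ → ℚ
bound k =
  ratio (+ (k ℕ.+ 1)) 2 -
  maxOver (λ t → ratio (+ t) (k ∸ 2) ⊓
                 ((ratio (+ (k ℕ.+ 1)) 2 - ratio (+ ((t ∸ 1) ℕ.^ 2)) 1)
                   * ratio (+ 1) (2 ℕ.* k ∸ 3)))
          (k ∸ 2)

{-# OPTIONS --safe #-}
module Submission where

-- Let G be the complement of H: a triangle-free graph on 2K + 1 vertices, K = k - 1. A k-set spanning
-- t edges of G gives a subgraph of H of density (k+1)/2 - t/(k-2), so it is enough that G is sparse or
-- has, for some t, such a k-set and at most K² + 1 - (t-1)² edges.
-- Take x of maximum degree Δ. If deg x + deg y ≤ n - 3 for all neighbours y of x, then summing degrees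
-- gives 2e ≤ Δ(2n - 3 - 2Δ), which is small enough. Otherwise N(x) and N(y) are disjoint independent
-- sets missing at most two vertices. If a single vertex z is missing, both parts have K vertices (or a
-- part contains an independent k-set). With p and s the numbers of neighbours of z in them, no edge of
-- G joins these neighbours, so e ≤ K² - ps + p + s = K² + 1 - (p-1)(s-1), and t = min(p, s) works. If
-- two vertices are missing and neither can be absorbed, e ≤ K(K-1) + 4.
--
-- Vertex sets are ℕ-valued weights, and pairs f h counts ordered edges with multiplicity f i * h j;
-- f is independent when pairs f f vanishes.

open import Defs hiding (sym)
open import Data.Nat using (ℕ; zero; suc; _+_; _*_; _^_; _∸_; _≤_; _<_; _<ᵇ_; z≤n; s≤s; _≤?_; _<?_)
open import Data.Nat.Properties hiding (_≟_)
open import Data.Nat.Tactic.RingSolver using (solve; solve-∀)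
import Data.Nat.ListAction as ListAction
import Data.Integer as ℤ
import Data.Integer.Properties as ℤ
open import Data.Bool using (Bool; true; false; if_then_else_; _∧_; _∨_; not)
import Data.Bool as Bool
open import Data.Bool.Properties using (∧-comm; ∧-zeroʳ)
open import Data.Fin using (Fin; zero; suc; toℕ)
open import Data.Fin.Properties using (any?; _≟_; toℕ-injective)
open import Data.Fin.Subset using (_∈_; ∣_∣)
open import Data.List using ([]; _∷_; map; allFin)
import Data.List as List
open import Data.List.Properties using (map-tabulate)
open import Data.Vec using (tabulate)
open import Data.Vec.Properties using (lookup∘tabulate; lookup⇒[]=; []=⇒lookup)
open import Data.Product using (∃; _×_; _,_; proj₁; proj₂)
open import Data.Sum using (_⊎_; inj₁; inj₂; map₂; [_,_]′)
open import Data.Empty using (⊥-elim)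
open import Function using (_∘_)
open import Relation.Nullary using (yes; no; does)
open import Relation.Nullary.Decidable using (_×-dec_; dec-true)
open import Relation.Binary.PropositionalEquality hiding ([_])
open import Algebra.Properties.Semiring.Sum +-*-semiring
  using (sum; sum-syntax; sum-cong-≗; ∑-distrib-+; ∑-comm; *-distribˡ-sum; *-distribʳ-sum)
open import Data.Rational using (ℚ)
import Data.Rational as ℚ
import Data.Rational.Properties as ℚ
open import Data.Rational.Solver using (module +-*-Solver)
open import Data.Rational.Unnormalised using (mkℚᵘ; *≤*) renaming (_≃_ to _≃ᵘ_)
import Data.Rational.Unnormalised as ℚᵘ
import Data.Rational.Unnormalised.Properties as ℚᵘ

private variable
  n : ℕ

-- An inequality certificate without subtraction: the equation says that `y - x` equals `r - l` plus
-- the slack `c`. The surplus `c` is given explicitly and the equation is left to the ring solver.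
≤-by : ∀ {x y l r} c → l ≤ r → x + r + c ≡ y + l → x ≤ y
≤-by {x} {y} {l} {r} c l≤r eq = +-cancelʳ-≤ l x y (begin
  x + l      ≤⟨ +-monoʳ-≤ x l≤r ⟩
  x + r      ≤⟨ m≤m+n (x + r) c ⟩
  x + r + c  ≡⟨ eq ⟩
  y + l      ∎)
  where open ≤-Reasoning

-- Weights and their sums

Weight : ℕ → Set
Weight n = Fin n → ℕ

infixl 6 _⊕_
_⊕_ : Weight n → Weight n → Weight n
(f ⊕ h) i = f i + h i

𝟙 : Weight n
𝟙 _ = 1

δ : Fin n → Weight n
δ zero    zero    = 1
δ zero    (suc _) = 0
δ (suc _) zero    = 0
δ (suc v) (suc i) = δ v i

ι : Bool → ℕ
ι b = if b then 1 else 0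

ι≤1 : ∀ b → ι b ≤ 1
ι≤1 true  = ≤-refl
ι≤1 false = z≤n

δ-refl : (v : Fin n) → δ v v ≡ 1
δ-refl zero    = refl
δ-refl (suc v) = δ-refl v

sum-mono : {f h : Weight n} → (∀ i → f i ≤ h i) → sum f ≤ sum h
sum-mono {zero}  le = z≤n
sum-mono {suc n} le = +-mono-≤ (le zero) (sum-mono (λ i → le (suc i)))

sum-zero : {f : Weight n} → (∀ i → f i ≡ 0) → sum f ≡ 0
sum-zero {zero}  f≡0 = refl
sum-zero {suc n} f≡0 = cong₂ _+_ (f≡0 zero) (sum-zero (λ i → f≡0 (suc i)))

sum≡0⇒≡0 : {f : Weight n} → sum f ≡ 0 → ∀ i → f i ≡ 0
sum≡0⇒≡0 {f = f} eq zero    = m+n≡0⇒m≡0 (f zero) eq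
sum≡0⇒≡0 {f = f} eq (suc i) = sum≡0⇒≡0 (m+n≡0⇒n≡0 (f zero) eq) i

sum-𝟙 : ∀ n → sum (𝟙 {n}) ≡ n
sum-𝟙 zero    = refl
sum-𝟙 (suc n) = cong suc (sum-𝟙 n)

sum-δ* : (v : Fin n) (f : Weight n) → ∑[ i < n ] (δ v i * f i) ≡ f v
sum-δ* zero    f = trans (cong₂ _+_ (*-identityˡ (f zero)) (sum-zero {f = λ i → 0 * f (suc i)} (λ _ → refl))) (+-identityʳ _)
sum-δ* (suc v) f = sum-δ* v (λ i → f (suc i))

sum-δ : (v : Fin n) → sum (δ v) ≡ 1
sum-δ v = trans (sum-cong-≗ (λ i → sym (*-identityʳ (δ v i)))) (sum-δ* v 𝟙)

sum-positive : {f : Weight n} → 1 ≤ sum f → ∃ λ i → 1 ≤ f i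
sum-positive {suc n} {f} pos with f zero in eq
... | suc m = zero , subst (1 ≤_) (sym eq) (s≤s z≤n)
... | zero with i , fi ← sum-positive pos = suc i , fi

remove : (f : Weight n) (u : Fin n) → 1 ≤ f u → ∃ λ f′ → ∀ i → f i ≡ (f′ ⊕ δ u) i
remove f u 1≤fu = (λ i → f i ∸ δ u i) , λ i → sym (m∸n+n≡m (δ≤f f u 1≤fu i))
  where
  δ≤f : ∀ {n} (f : Weight n) u → 1 ≤ f u → ∀ i → δ u i ≤ f i
  δ≤f f zero    1≤ zero    = 1≤
  δ≤f f zero    1≤ (suc i) = z≤n
  δ≤f f (suc u) 1≤ zero    = z≤n
  δ≤f f (suc u) 1≤ (suc i) = δ≤f (λ j → f (suc j)) u 1≤ i

-- Cuts an independent set that is too large down to exactly `K + 1` vertices; `Indep-≤` keeps it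
-- independent.
shrink : (f : Weight n) (m : ℕ) → m ≤ sum f → ∃ λ f′ → (∀ i → f′ i ≤ f i) × sum f′ ≡ m
shrink {zero}  f .zero z≤n = f , (λ ()) , refl
shrink {suc n} f m m≤ with m ≤? f zero
... | yes m≤f0 = f′ , f′≤f , trans (cong (m +_) (sum-zero {n} (λ _ → refl))) (+-identityʳ m)
  where
  f′ : Weight (suc n)
  f′ zero    = m
  f′ (suc _) = 0
  f′≤f : ∀ i → f′ i ≤ f i
  f′≤f zero    = m≤f0
  f′≤f (suc _) = z≤n
... | no m≰f0
  with h , h≤f , sum-h ← shrink (λ i → f (suc i)) (m ∸ f zero) (m≤n+o⇒m∸n≤o m (f zero) m≤)
  = f′ , f′≤f , trans (cong (f zero +_) sum-h) (m+[n∸m]≡n (<⇒≤ (≰⇒> m≰f0)))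
  where
  f′ : Weight (suc n)
  f′ zero    = f zero
  f′ (suc i) = h i
  f′≤f : ∀ i → f′ i ≤ f i
  f′≤f zero    = ≤-refl
  f′≤f (suc i) = h≤f i

argmax : (f : Weight (suc n)) → ∃ λ x → ∀ i → f i ≤ f x
argmax {zero} f = zero , λ { zero → ≤-refl }
argmax {suc n} f with argmax (λ i → f (suc i))
... | x , max with f zero ≤? f (suc x)
... | yes le = suc x , λ { zero → le ; (suc i) → max i }
... | no  gt = zero , λ { zero → ≤-refl ; (suc i) → ≤-trans (max i) (<⇒≤ (≰⇒> gt)) }

-- Bilinear forms on weights

bilinear : (Fin n → Fin n → ℕ) → Weight n → Weight n → ℕ
bilinear {n} M f h = ∑[ j < n ] (h j * ∑[ i < n ] (f i * M i j))

module _ {n : ℕ} where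

  bilinear-mono : ∀ {M M′ : Fin n → Fin n → ℕ} {f f′ h h′ : Weight n} →
    (∀ i j → M i j ≤ M′ i j) → (∀ i → f i ≤ f′ i) → (∀ j → h j ≤ h′ j) →
    bilinear M f h ≤ bilinear M′ f′ h′
  bilinear-mono M≤ f≤ h≤ = sum-mono λ j → *-mono-≤ (h≤ j) (sum-mono λ i → *-mono-≤ (f≤ i) (M≤ i j))

  bilinear-cong : ∀ (M : Fin n → Fin n → ℕ) {f f′ h h′ : Weight n} →
    (∀ i → f i ≡ f′ i) → (∀ j → h j ≡ h′ j) → bilinear M f h ≡ bilinear M f′ h′
  bilinear-cong M f≡ h≡ = sum-cong-≗ λ j → cong₂ _*_ (h≡ j) (sum-cong-≗ λ i → cong (_* M i j) (f≡ i))

  bilinear-⊕ᴹ : ∀ (M M′ : Fin n → Fin n → ℕ) f h →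
    bilinear (λ i j → M i j + M′ i j) f h ≡ bilinear M f h + bilinear M′ f h
  bilinear-⊕ᴹ M M′ f h = trans
    (sum-cong-≗ λ j → trans
      (cong (h j *_) (trans (sum-cong-≗ λ i → *-distribˡ-+ (f i) (M i j) (M′ i j)) (∑-distrib-+ {n} _ _)))
      (*-distribˡ-+ (h j) _ _))
    (∑-distrib-+ {n} _ _)

  bilinear-⊕ˡ : ∀ (M : Fin n → Fin n → ℕ) f f′ h →
    bilinear M (f ⊕ f′) h ≡ bilinear M f h + bilinear M f′ h
  bilinear-⊕ˡ M f f′ h = trans
    (sum-cong-≗ λ j → trans
      (cong (h j *_) (trans (sum-cong-≗ λ i → *-distribʳ-+ (M i j) (f i) (f′ i)) (∑-distrib-+ {n} _ _)))
      (*-distribˡ-+ (h j) _ _))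
    (∑-distrib-+ {n} _ _)

  bilinear-⊕ʳ : ∀ (M : Fin n → Fin n → ℕ) f h h′ →
    bilinear M f (h ⊕ h′) ≡ bilinear M f h + bilinear M f h′
  bilinear-⊕ʳ M f h h′ = trans (sum-cong-≗ λ j → *-distribʳ-+ _ (h j) (h′ j)) (∑-distrib-+ {n} _ _)

  bilinear-sym : ∀ (M : Fin n → Fin n → ℕ) → (∀ i j → M i j ≡ M j i) →
    ∀ f h → bilinear M f h ≡ bilinear M h f
  bilinear-sym M M-sym f h = begin
    ∑[ j < n ] (h j * ∑[ i < n ] (f i * M i j))  ≡⟨ sum-cong-≗ (λ j → *-distribˡ-sum (h j) (λ i → f i * M i j)) ⟩
    ∑[ j < n ] ∑[ i < n ] (h j * (f i * M i j))  ≡⟨ ∑-comm {n} {n} _ ⟩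
    ∑[ i < n ] ∑[ j < n ] (h j * (f i * M i j))  ≡⟨ sum-cong-≗ (λ i → sum-cong-≗ (λ j → swap i j)) ⟩
    ∑[ i < n ] ∑[ j < n ] (f i * (h j * M j i))  ≡⟨ sum-cong-≗ (λ i → sym (*-distribˡ-sum (f i) (λ j → h j * M j i))) ⟩
    ∑[ i < n ] (f i * ∑[ j < n ] (h j * M j i))  ∎
    where
    open ≡-Reasoning
    rearrange : ∀ a b c → a * (b * c) ≡ b * (a * c)
    rearrange = solve-∀
    swap : ∀ i j → h j * (f i * M i j) ≡ f i * (h j * M j i)
    swap i j = trans (rearrange (h j) (f i) (M i j)) (cong (λ m → f i * (h j * m)) (M-sym i j))

  -- A matrix of rank one separates into two sums. With neighbourhood indicators for `a` and `b` it
  -- evaluates the number of pairs in a rectangle of neighbours, such as `p * s`.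
  bilinear-product : ∀ (a b f h : Weight n) →
    bilinear (λ i j → a i * b j) f h ≡ ∑[ i < n ] (f i * a i) * ∑[ j < n ] (h j * b j)
  bilinear-product a b f h = begin
    ∑[ j < n ] (h j * ∑[ i < n ] (f i * (a i * b j)))
      ≡⟨ sum-cong-≗ (λ j → cong (h j *_) (trans
           (sum-cong-≗ (λ i → sym (*-assoc (f i) (a i) (b j))))
           (sym (*-distribʳ-sum (b j) (λ i → f i * a i))))) ⟩
    ∑[ j < n ] (h j * (A * b j))
      ≡⟨ sum-cong-≗ (λ j → rearrange (h j) A (b j)) ⟩
    ∑[ j < n ] (A * (h j * b j))
      ≡⟨ sym (*-distribˡ-sum A (λ j → h j * b j)) ⟩
    A * ∑[ j < n ] (h j * b j) ∎
    where
    open ≡-Reasoning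
    A = ∑[ i < n ] (f i * a i)
    rearrange : ∀ x y z → x * (y * z) ≡ y * (x * z)
    rearrange = solve-∀

  bilinear-1 : ∀ (f h : Weight n) → bilinear (λ _ _ → 1) f h ≡ sum f * sum h
  bilinear-1 f h = trans (bilinear-product 𝟙 𝟙 f h)
    (cong₂ _*_ (sum-cong-≗ (λ i → *-identityʳ (f i))) (sum-cong-≗ (λ j → *-identityʳ (h j))))

-- Triangle-freeness and three integer inequalities

TriangleFree : Graph n → Set
TriangleFree G = ∀ i j l → adj G i l ≡ true → adj G j l ≡ true → adj G i j ≡ false

-- In the application `suc P`, `suc S`, `suc P′`, `suc S′` are the degrees of the two leftover
-- vertices into the two parts, and `a`, `b` count their common neighbours there. For a, b ≥ 2 both
-- products on the right are at least (a-1)(b-1), and 2(a-1)(b-1) + 2 - ab = (a-2)(b-2). For a = 1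
-- one of `P`, `P′` is positive, so the right side is at least (b-1) + 2; the case b = 1 is
-- symmetric.
ab-bound : ∀ P S P′ S′ a b → a ≤ suc P → a ≤ suc P′ → b ≤ suc S → b ≤ suc S′ →
  a ≡ 0 ⊎ 1 ≤ P + P′ → b ≡ 0 ⊎ 1 ≤ S + S′ → a * b ≤ P * S + P′ * S′ + 2
ab-bound P S P′ S′ zero b _ _ _ _ _ _ = z≤n
ab-bound P S P′ S′ (suc α) zero _ _ _ _ _ _ = ≤-trans (≤-reflexive (*-zeroʳ α)) z≤n
ab-bound P S P′ S′ (suc zero) (suc β) _ _ (s≤s β≤S) (s≤s β≤S′) (inj₂ 1≤P+P′) _ = case P P′ 1≤P+P′
  where
  case : ∀ P P′ → 1 ≤ P + P′ → 1 * suc β ≤ P * S + P′ * S′ + 2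
  case (suc P) P′ _ = ≤-by (P * S + P′ * S′ + 1) β≤S (solve (β ∷ P ∷ S ∷ P′ ∷ S′ ∷ []))
  case zero (suc P′) _ = ≤-by (P′ * S′ + 1) β≤S′ (solve (β ∷ P′ ∷ S′ ∷ []))
ab-bound P S P′ S′ (suc (suc α)) (suc zero) (s≤s α≤P) (s≤s α≤P′) _ _ _ (inj₂ 1≤S+S′) = case S S′ 1≤S+S′
  where
  case : ∀ S S′ → 1 ≤ S + S′ → suc (suc α) * 1 ≤ P * S + P′ * S′ + 2
  case (suc S) S′ _ = ≤-by (P * S + P′ * S′ + 1) α≤P (solve (α ∷ P ∷ S ∷ P′ ∷ S′ ∷ []))
  case zero (suc S′) _ = ≤-by (P′ * S′ + 1) α≤P′ (solve (α ∷ P ∷ P′ ∷ S′ ∷ []))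
ab-bound P S P′ S′ (suc (suc α)) (suc (suc β)) (s≤s α≤P) (s≤s α≤P′) (s≤s β≤S) (s≤s β≤S′) _ _ =
  ≤-by (α * β) (+-mono-≤ (*-mono-≤ α≤P β≤S) (*-mono-≤ α≤P′ β≤S′)) (identity α β (P * S) (P′ * S′))
  where
  identity : ∀ α β X Y →
    suc (suc α) * suc (suc β) + (X + Y) + α * β ≡ X + Y + 2 + (suc α * suc β + suc α * suc β)
  identity = solve-∀

-- The factors have the odd sum 2K - 1, so the smaller one is K - 1 - c for some c, and the product
-- is K(K-1) - c² - c.
split-product : ∀ a b K → suc (a + b) ≡ K + K → a * b + K ≤ K * K
split-product a b K eq = [ ordered a b eq , (λ b≤a → subst (λ m → m + K ≤ K * K) (*-comm b a)
    (ordered b a (trans (cong suc (+-comm b a)) eq) b≤a)) ]′ (≤-total a b)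
  where
  ordered : ∀ a b → suc (a + b) ≡ K + K → a ≤ b → a * b + K ≤ K * K
  ordered a b eq a≤b with a + 0 <? K
  ... | no a≮K = ⊥-elim (<-irrefl (sym eq) (s≤s (+-mono-≤ K≤a (≤-trans K≤a a≤b))))
    where
    K≤a : K ≤ a
    K≤a = subst (K ≤_) (+-identityʳ a) (≮⇒≥ a≮K)
  ... | yes a<K with c , refl ← m≤n⇒∃[o]m+o≡n a<K
               rewrite +-identityʳ a
               with refl ← +-cancelˡ-≡ (suc a) b (a + c + suc c) (trans eq (solve (a ∷ c ∷ [])))
    = ≤-by (c * c + c) (≤-refl {0}) (solve (a ∷ c ∷ []))

-- The hypothesis reads E ≤ D(4K - 1 - 2D). Over the integers this concave quadratic is largest at D
-- = K, with value 2K² - K; writing D = K + c or D = K - 1 - c gives the slack.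
degree-optimum : ∀ E D K → E + D * (D + D + 3) ≤ D * suc (K + K) + suc (K + K) * D → E + K ≤ 2 * (K * K)
degree-optimum E D K bound with K ≤? D
... | yes K≤D with c , refl ← m≤n⇒∃[o]m+o≡n K≤D
  = ≤-by (2 * (c * c) + c) bound (solve (E ∷ K ∷ c ∷ []))
... | no K≰D with c , refl ← m≤n⇒∃[o]m+o≡n (≰⇒> K≰D)
  = ≤-by (1 + 3 * c + 2 * (c * c)) bound (solve (E ∷ D ∷ c ∷ []))

-- Edge counts in a graph and the case distinction

module Counting (G : Graph n) where

  g : Fin n → Fin n → ℕ
  g i j = ι (adj G i j)

  g-sym : ∀ i j → g i j ≡ g j i
  g-sym i j = cong ι (Graph.sym G i j)

  pairs : Weight n → Weight n → ℕ
  pairs = bilinear g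

  deg : Weight n → Fin n → ℕ
  deg f v = ∑[ i < n ] (f i * g i v)

  -- twice the number of edges
  E : ℕ
  E = pairs 𝟙 𝟙

  deg-⊕ : ∀ f h v → deg (f ⊕ h) v ≡ deg f v + deg h v
  deg-⊕ f h v = trans (sum-cong-≗ λ i → *-distribʳ-+ (g i v) (f i) (h i)) (∑-distrib-+ {n} _ _)

  deg-δ : ∀ u v → deg (δ u) v ≡ g u v
  deg-δ u v = sum-δ* u (λ i → g i v)

  pairs-δ : ∀ f v → pairs f (δ v) ≡ deg f v
  pairs-δ f v = sum-δ* v (deg f)

  pairs-⊕ : ∀ f h → pairs (f ⊕ h) (f ⊕ h) ≡ pairs f f + 2 * pairs f h + pairs h h
  pairs-⊕ f h = begin
    pairs (f ⊕ h) (f ⊕ h)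
      ≡⟨ bilinear-⊕ʳ g (f ⊕ h) f h ⟩
    pairs (f ⊕ h) f + pairs (f ⊕ h) h
      ≡⟨ cong₂ _+_ (bilinear-⊕ˡ g f h f) (bilinear-⊕ˡ g f h h) ⟩
    pairs f f + pairs h f + (pairs f h + pairs h h)
      ≡⟨ cong (λ m → pairs f f + m + (pairs f h + pairs h h)) (bilinear-sym g g-sym h f) ⟩
    pairs f f + pairs f h + (pairs f h + pairs h h)
      ≡⟨ identity (pairs f f) (pairs f h) (pairs h h) ⟩
    pairs f f + 2 * pairs f h + pairs h h ∎
    where
    open ≡-Reasoning
    identity : ∀ x y z → x + y + (y + z) ≡ x + 2 * y + z
    identity = solve-∀

  pairs-⊕δ : ∀ f v → pairs (f ⊕ δ v) (f ⊕ δ v) ≡ pairs f f + 2 * deg f v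
  pairs-⊕δ f v = begin
    pairs (f ⊕ δ v) (f ⊕ δ v)
      ≡⟨ pairs-⊕ f (δ v) ⟩
    pairs f f + 2 * pairs f (δ v) + pairs (δ v) (δ v)
      ≡⟨ cong₂ (λ a b → pairs f f + 2 * a + b) (pairs-δ f v)
           (trans (pairs-δ (δ v) v) (trans (deg-δ v v) (cong ι (irrefl G v)))) ⟩
    pairs f f + 2 * deg f v + 0
      ≡⟨ +-identityʳ _ ⟩
    pairs f f + 2 * deg f v ∎
    where open ≡-Reasoning

  Indep : Weight n → Set
  Indep f = pairs f f ≡ 0

  Indep-⊕δ : ∀ f v → Indep f → deg f v ≡ 0 → Indep (f ⊕ δ v)
  Indep-⊕δ f v ind deg≡0 = trans (pairs-⊕δ f v) (cong₂ (λ a b → a + 2 * b) ind deg≡0)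

  Indep-≤ : ∀ f f′ → (∀ i → f′ i ≤ f i) → Indep f → Indep f′
  Indep-≤ f f′ f′≤f ind = n≤0⇒n≡0 (subst (pairs f′ f′ ≤_) ind (bilinear-mono {f = f′} {f} {f′} {f} (λ _ _ → ≤-refl) f′≤f f′≤f))

  -- Requiring the weights to add up to 1 everywhere expresses at once that `f`, `h` and `z` are
  -- disjoint, that they cover all vertices, and that the weights are 0 or 1.
  record NearBipartite : Set where
    field
      f h     : Weight n
      z       : Fin n
      f-indep : Indep f
      h-indep : Indep h
      part    : ∀ i → (f ⊕ h ⊕ δ z) i ≡ 1

  record TwoDefects : Set where
    field
      f h     : Weight n
      v w     : Fin n
      f-indep : Indep f
      h-indep : Indep h
      part    : ∀ i → (f ⊕ h ⊕ δ v ⊕ δ w) i ≡ 1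

  -- `E` is twice the number e of edges: the first two cases say e ≤ K² - K/2 and e ≤ K² - K + 4,
  -- and both end in the choice of index 1 in the maximum. In `few-edges` the index is `suc t`, the
  -- number of edges spanned by the k-set, so that `t * t` is (index - 1)².
  data Dichotomy (K : ℕ) : Set where
    sparse  : E + K ≤ 2 * (K * K) → Dichotomy K
    sparse′ : E + 2 * K ≤ 2 * (K * K) + 8 → Dichotomy K
    independent : (f : Weight n) → (∀ i → f i ≤ 1) → sum f ≡ suc K → Indep f → Dichotomy K
    few-edges : (t : ℕ) (f : Weight n) → (∀ i → f i ≤ 1) → sum f ≡ suc K →
      pairs f f ≡ 2 * suc t → E + 2 * (t * t) ≤ 2 * (K * K) + 2 → Dichotomy K

-- One exceptional vertex

module _ {G : Graph n} (tf : TriangleFree G) where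
  open Counting G

  private
    -- An edge between two neighbours of `v` would close a triangle. Summed over both parts, this
    -- bounds the crossing edges plus the pairs of neighbours of `v`.
    one-rectangle : ∀ i j v → g i j + g i v * g j v ≤ 1
    one-rectangle i j v with adj G i v in iv | adj G j v in jv
    ... | true  | true  rewrite tf i j v iv jv = ≤-refl
    ... | true  | false = subst (_≤ 1) (sym (+-identityʳ _)) (ι≤1 (adj G i j))
    ... | false | _     = subst (_≤ 1) (sym (+-identityʳ _)) (ι≤1 (adj G i j))

    no-rectangle : ∀ i j v → adj G i j ≡ true → g i v * g j v ≡ 0
    no-rectangle i j v ij with adj G i v in iv | adj G j v in jv
    ... | true  | true with () ← trans (sym ij) (tf i j v iv jv)
    ... | true  | false = refl
    ... | false | _     = refl

    -- On an edge `i j` both rectangles vanish; on a nonedge this is x + y ≤ 1 + xy for 0/1 values.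
    -- The last product is grouped by endpoint so that it has rank one in `i` and `j`.
    two-rectangles : ∀ i j v w →
      g i j + g i v * g j v + g i w * g j w ≤ 1 + (g i v * g i w) * (g j v * g j w)
    two-rectangles i j v w with adj G i j in ij
    ... | true rewrite no-rectangle i j v ij | no-rectangle i j w ij = s≤s z≤n
    ... | false with adj G i v | adj G j v | adj G i w | adj G j w
    ... | true  | true  | true  | true  = ≤-refl
    ... | true  | true  | true  | false = ≤-refl
    ... | true  | true  | false | _     = ≤-refl
    ... | true  | false | true  | true  = ≤-refl
    ... | true  | false | true  | false = z≤n
    ... | true  | false | false | _     = z≤n
    ... | false | _     | true  | true  = ≤-refl
    ... | false | _     | true  | false = z≤n
    ... | false | _     | false | _     = z≤n

    ordered-dichotomy : ∀ {K} → n ≡ suc (K + K) → (nb : NearBipartite) →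
      (let module nb = NearBipartite nb) → deg nb.f nb.z ≤ deg nb.h nb.z → Dichotomy K
    ordered-dichotomy {K} n≡ nb p≤s = result
      where
      open NearBipartite nb
      p = deg f z
      s = deg h z
      C = pairs f h

      f≤1 : ∀ i → f i ≤ 1
      f≤1 i = subst (f i ≤_) (part i) (≤-trans (m≤m+n (f i) (h i)) (m≤m+n _ _))
      h≤1 : ∀ i → h i ≤ 1
      h≤1 i = subst (h i ≤_) (part i) (≤-trans (m≤n+m (h i) (f i)) (m≤m+n _ _))
      f⊕δ≤1 : ∀ i → (f ⊕ δ z) i ≤ 1
      f⊕δ≤1 i = subst ((f ⊕ δ z) i ≤_) (part i) (+-monoˡ-≤ (δ z i) (m≤m+n (f i) (h i)))

      size : sum f + sum h ≡ K + K
      size = suc-injective (begin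
        suc (sum f + sum h)         ≡⟨ +-comm 1 _ ⟩
        sum f + sum h + 1           ≡⟨ cong₂ _+_ (sym (∑-distrib-+ f h)) (sym (sum-δ z)) ⟩
        sum (f ⊕ h) + sum (δ z)     ≡⟨ sym (∑-distrib-+ (f ⊕ h) (δ z)) ⟩
        sum (f ⊕ h ⊕ δ z)           ≡⟨ sum-cong-≗ part ⟩
        sum {n} 𝟙                   ≡⟨ trans (sum-𝟙 n) n≡ ⟩
        suc (K + K)                 ∎)
        where open ≡-Reasoning

      E-value : E ≡ 2 * C + 2 * (p + s)
      E-value = begin
        E
          ≡⟨ bilinear-cong g (λ i → sym (part i)) (λ i → sym (part i)) ⟩
        pairs (f ⊕ h ⊕ δ z) (f ⊕ h ⊕ δ z)
          ≡⟨ pairs-⊕δ (f ⊕ h) z ⟩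
        pairs (f ⊕ h) (f ⊕ h) + 2 * deg (f ⊕ h) z
          ≡⟨ cong₂ (λ a b → a + 2 * b) (pairs-⊕ f h) (deg-⊕ f h z) ⟩
        pairs f f + 2 * C + pairs h h + 2 * (p + s)
          ≡⟨ cong₂ (λ a b → a + 2 * C + b + 2 * (p + s)) f-indep h-indep ⟩
        2 * C + 0 + 2 * (p + s)
          ≡⟨ cong (_+ 2 * (p + s)) (+-identityʳ (2 * C)) ⟩
        2 * C + 2 * (p + s) ∎
        where open ≡-Reasoning

      crossing : C + p * s ≤ sum f * sum h
      crossing = begin
        C + p * s
          ≡⟨ cong (C +_) (sym (bilinear-product (λ i → g i z) (λ j → g j z) f h)) ⟩
        C + bilinear (λ i j → g i z * g j z) f h
          ≡⟨ sym (bilinear-⊕ᴹ g (λ i j → g i z * g j z) f h) ⟩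
        bilinear (λ i j → g i j + g i z * g j z) f h
          ≤⟨ bilinear-mono {f = f} {f} {h} {h} (λ i j → one-rectangle i j z) (λ _ → ≤-refl) (λ _ → ≤-refl) ⟩
        bilinear (λ _ _ → 1) f h
          ≡⟨ bilinear-1 f h ⟩
        sum f * sum h ∎
        where open ≤-Reasoning

      large : ∀ f′ → (∀ i → f′ i ≤ 1) → Indep f′ → suc K ≤ sum f′ → Dichotomy K
      large f′ f′≤1 ind big with f″ , f″≤ , size″ ← shrink f′ (suc K) big =
        independent f″ (λ i → ≤-trans (f″≤ i) (f′≤1 i)) size″ (Indep-≤ f′ f″ f″≤ ind)

      balanced : p ≤ s → sum f ≡ K → sum h ≡ K → Dichotomy K
      balanced le f≡K h≡K with p in p≡ | s in s≡ | le
      ... | zero   | _      | _ = independent (f ⊕ δ z) f⊕δ≤1 size′ (Indep-⊕δ f z f-indep p≡)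
        where
        size′ : sum (f ⊕ δ z) ≡ suc K
        size′ = trans (∑-distrib-+ f (δ z)) (trans (cong₂ _+_ f≡K (sum-δ z)) (+-comm K 1))
      -- `f` with `z` has K + 1 vertices and spans exactly `suc p′` edges. Expanding K² - ps + p + s
      -- gives K² + 1 - p′s′, and p′ ≤ s′ lets the square of p′ replace p′s′.
      ... | suc p′ | suc s′ | s≤s p′≤s′ = few-edges p′ (f ⊕ δ z) f⊕δ≤1 size′
          (trans (pairs-⊕δ f z) (cong₂ (λ a b → a + 2 * b) f-indep p≡)) bound′
        where
        size′ : sum (f ⊕ δ z) ≡ suc K
        size′ = trans (∑-distrib-+ f (δ z)) (trans (cong₂ _+_ f≡K (sum-δ z)) (+-comm K 1))
        E-value′ : E ≡ 2 * C + 2 * (suc p′ + suc s′)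
        E-value′ = trans E-value (cong₂ (λ a b → 2 * C + 2 * (a + b)) p≡ s≡)
        crossing′ : C + suc p′ * suc s′ ≤ K * K
        crossing′ = subst₂ _≤_ (cong₂ (λ a b → C + a * b) p≡ s≡) (cong₂ _*_ f≡K h≡K) crossing
        identity : ∀ C K² p′ s′ x → 2 * C + 2 * (suc p′ + suc s′) + 2 * x + 2 * (K² + p′ * s′) + 0
          ≡ 2 * K² + 2 + 2 * (C + suc p′ * suc s′ + x)
        identity = solve-∀
        bound′ : E + 2 * (p′ * p′) ≤ 2 * (K * K) + 2
        bound′ = subst (λ e → e + 2 * (p′ * p′) ≤ 2 * (K * K) + 2) (sym E-value′)
          (≤-by 0 (*-monoʳ-≤ 2 (+-mono-≤ crossing′ (*-monoʳ-≤ p′ p′≤s′))) (identity C (K * K) p′ s′ (p′ * p′)))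

      result : Dichotomy K
      -- The parts have 2K vertices together, so either one has more than K or both have exactly K.
      result with suc K ≤? sum f | suc K ≤? sum h
      ... | yes big | _       = large f f≤1 f-indep big
      ... | no _    | yes big = large h h≤1 h-indep big
      ... | no f≯K  | no h≯K  = balanced p≤s
          (≤-antisym f≤K (+-cancelʳ-≤ K K (sum f) (≤-trans (≤-reflexive (sym size)) (+-monoʳ-≤ (sum f) h≤K))))
          (≤-antisym h≤K (+-cancelˡ-≤ K K (sum h) (≤-trans (≤-reflexive (sym size)) (+-monoˡ-≤ (sum h) f≤K))))
        where
        f≤K = ≮⇒≥ f≯K
        h≤K = ≮⇒≥ h≯K

  nearBipartite-dichotomy : ∀ {K} → n ≡ suc (K + K) → NearBipartite → Dichotomy K
  nearBipartite-dichotomy n≡ nb = [ ordered-dichotomy n≡ nb , ordered-dichotomy n≡ swapped ]′ (≤-total _ _)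
    where
    swapped : NearBipartite
    swapped = record
      { f = nb.h ; h = nb.f ; z = nb.z ; f-indep = nb.h-indep ; h-indep = nb.f-indep
      ; part = λ i → trans (cong (_+ δ nb.z i) (+-comm (nb.h i) (nb.f i))) (nb.part i) }
      where module nb = NearBipartite nb

  -- Two exceptional vertices

  private
    common : Weight n → Fin n → Fin n → ℕ
    common f v w = ∑[ i < n ] (f i * (g i v * g i w))

    common≤ˡ : ∀ f v w → common f v w ≤ deg f v
    common≤ˡ f v w = sum-mono λ i → *-monoʳ-≤ (f i)
      (≤-trans (*-monoʳ-≤ (g i v) (ι≤1 (adj G i w))) (≤-reflexive (*-identityʳ (g i v))))

    common≤ʳ : ∀ f v w → common f v w ≤ deg f w
    common≤ʳ f v w = sum-mono λ i → *-monoʳ-≤ (f i)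
      (≤-trans (*-monoˡ-≤ (g i w) (ι≤1 (adj G i v))) (≤-reflexive (*-identityˡ (g i w))))

    adjacent⇒common≡0 : ∀ f v w → adj G v w ≡ true → common f v w ≡ 0
    adjacent⇒common≡0 f v w vw = sum-zero λ i → trans (cong (f i *_) (product≡0 i)) (*-zeroʳ (f i))
      where
      product≡0 : ∀ i → g i v * g i w ≡ 0
      product≡0 i with adj G i w in iw
      ... | false = *-zeroʳ (g i v)
      ... | true rewrite tf i v w iw vw = refl

    common-neighbour : ∀ f v w → 1 ≤ common f v w →
      ∃ λ u → 1 ≤ f u × adj G u v ≡ true × adj G u w ≡ true
    common-neighbour f v w pos with u , 1≤ ← sum-positive pos = u , split u 1≤
      where
      split : ∀ u → 1 ≤ f u * (g u v * g u w) → 1 ≤ f u × adj G u v ≡ true × adj G u w ≡ true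
      split u 1≤ with f u | adj G u v | adj G u w
      ... | suc _ | true  | true  = s≤s z≤n , refl , refl
      ... | suc m | true  | false with () ← subst (1 ≤_) (*-zeroʳ m) 1≤
      ... | suc m | false | _     with () ← subst (1 ≤_) (*-zeroʳ m) 1≤

  -- If u is the only neighbour in f of both v and w, then trading u for v and w leaves a
  -- bipartition that misses only u.
  one-sided : (d : TwoDefects) → (let module d = TwoDefects d) →
    NearBipartite ⊎ (1 ≤ deg d.f d.v × 1 ≤ deg d.f d.w ×
      (common d.f d.v d.w ≡ 0 ⊎ 3 ≤ deg d.f d.v + deg d.f d.w))
  one-sided d with 1 ≤? deg f v | 1 ≤? deg f w | 1 ≤? common f v w | 3 ≤? deg f v + deg f w
    where open TwoDefects d
  ... | no p≡0 | _ | _ | _ = inj₁ record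
      { f = f ⊕ δ v ; h = h ; z = w
      ; f-indep = Indep-⊕δ f v f-indep (n<1⇒n≡0 (≰⇒> p≡0)) ; h-indep = h-indep
      ; part = λ i → trans (identity (f i) (h i) (δ v i) (δ w i)) (part i) }
    where
    open TwoDefects d
    identity : ∀ a b c e → a + c + b + e ≡ a + b + c + e
    identity = solve-∀
  ... | yes _ | no p≡0 | _ | _ = inj₁ record
      { f = f ⊕ δ w ; h = h ; z = v
      ; f-indep = Indep-⊕δ f w f-indep (n<1⇒n≡0 (≰⇒> p≡0)) ; h-indep = h-indep
      ; part = λ i → trans (identity (f i) (h i) (δ v i) (δ w i)) (part i) }
    where
    open TwoDefects d
    identity : ∀ a b c e → a + e + b + c ≡ a + b + c + e
    identity = solve-∀
  ... | yes 1≤p | yes 1≤p′ | no c≡0 | _ = inj₂ (1≤p , 1≤p′ , inj₁ (n<1⇒n≡0 (≰⇒> c≡0)))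
  ... | yes 1≤p | yes 1≤p′ | yes _ | yes 3≤ = inj₂ (1≤p , 1≤p′ , inj₂ 3≤)
  -- A common neighbour together with total degree at most 2 forces both degrees to be 1. The same
  -- `u` makes `v` and `w` nonadjacent, because G has no triangle.
  ... | yes 1≤p | yes 1≤p′ | yes 1≤c | no 3≰
    with u , 1≤fu , uv , uw ← common-neighbour (TwoDefects.f d) (TwoDefects.v d) (TwoDefects.w d) 1≤c
    with f′ , f≡ ← remove (TwoDefects.f d) u 1≤fu = inj₁ record
      { f = f′ ⊕ δ v ⊕ δ w ; h = h ; z = u
      ; f-indep = Indep-⊕δ (f′ ⊕ δ v) w
          (Indep-⊕δ f′ v (Indep-≤ f f′ f′≤f f-indep) (deg-f′≡0 v uv p≤1))
          (trans (deg-⊕ f′ (δ v) w)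
            (cong₂ _+_ (deg-f′≡0 w uw p′≤1) (trans (deg-δ v w) (cong ι (tf v w u (flip uv) (flip uw))))))
      ; h-indep = h-indep
      ; part = λ i → trans (identity (f′ i) (h i) (δ v i) (δ w i) (δ u i))
          (trans (cong (λ m → m + h i + δ v i + δ w i) (sym (f≡ i))) (part i)) }
    where
    open TwoDefects d
    identity : ∀ a b c e x → a + c + e + b + x ≡ a + x + b + c + e
    identity = solve-∀
    flip : ∀ {i j} → adj G i j ≡ true → adj G j i ≡ true
    flip {i} {j} ij = trans (Graph.sym G j i) ij
    p+p′≤2 : deg f v + deg f w ≤ 2
    p+p′≤2 = ≤-pred (≰⇒> 3≰)
    p≤1 : deg f v ≤ 1
    p≤1 = +-cancelʳ-≤ 1 _ 1 (≤-trans (+-monoʳ-≤ (deg f v) 1≤p′) p+p′≤2)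
    p′≤1 : deg f w ≤ 1
    p′≤1 = +-cancelˡ-≤ 1 _ 1 (≤-trans (+-monoˡ-≤ (deg f w) 1≤p) p+p′≤2)
    f′≤f : ∀ i → f′ i ≤ f i
    f′≤f i = subst (f′ i ≤_) (sym (f≡ i)) (m≤m+n (f′ i) (δ u i))
    deg-f′≡0 : ∀ x → adj G u x ≡ true → deg f x ≤ 1 → deg f′ x ≡ 0
    deg-f′≡0 x ux deg≤1 = n≤0⇒n≡0 (+-cancelʳ-≤ 1 _ 0 (subst (_≤ 1) (begin
      deg f x             ≡⟨ sum-cong-≗ (λ i → cong (_* g i x) (f≡ i)) ⟩
      deg (f′ ⊕ δ u) x    ≡⟨ deg-⊕ f′ (δ u) x ⟩
      deg f′ x + deg (δ u) x ≡⟨ cong (deg f′ x +_) (trans (deg-δ u x) (cong ι ux)) ⟩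
      deg f′ x + 1        ∎) deg≤1))
      where open ≡-Reasoning

  -- If no trade leads to a single exceptional vertex, three bounds combine: `crossing` for the
  -- edges between the parts, |f||h| ≤ K² - K from `split-product`, and `defect`, by which the edges
  -- at `v` and `w`, together with the overlap `a * b`, outweigh the lost rectangles by at most 4.
  twoDefects-sparse : ∀ {K} → n ≡ suc (K + K) → TwoDefects → NearBipartite ⊎ E + 2 * K ≤ 2 * (K * K) + 8
  twoDefects-sparse {K} n≡ d with one-sided d | one-sided swapped
    where
    open TwoDefects d
    swapped : TwoDefects
    swapped = record
      { f = h ; h = f ; v = v ; w = w ; f-indep = h-indep ; h-indep = f-indep
      ; part = λ i → trans (cong (λ m → m + δ v i + δ w i) (+-comm (h i) (f i))) (part i) }
  ... | inj₁ nb | _ = inj₁ nb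
  ... | inj₂ _ | inj₁ nb = inj₁ nb
  ... | inj₂ (1≤p , 1≤p′ , a?) | inj₂ (1≤s , 1≤s′ , b?) = inj₂ few
    where
    open TwoDefects d
    p = deg f v
    p′ = deg f w
    s = deg h v
    s′ = deg h w
    a = common f v w
    b = common h v w
    C = pairs f h

    size : suc (sum f + sum h) ≡ K + K
    size = suc-injective (begin
      suc (suc (sum f + sum h))          ≡⟨ trans (+-comm 2 _) (sym (+-assoc _ 1 1)) ⟩
      sum f + sum h + 1 + 1              ≡⟨ cong₂ (λ x y → x + y + 1) (sym (∑-distrib-+ f h)) (sym (sum-δ v)) ⟩
      sum (f ⊕ h) + sum (δ v) + 1        ≡⟨ cong₂ _+_ (sym (∑-distrib-+ (f ⊕ h) (δ v))) (sym (sum-δ w)) ⟩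
      sum (f ⊕ h ⊕ δ v) + sum (δ w)      ≡⟨ sym (∑-distrib-+ (f ⊕ h ⊕ δ v) (δ w)) ⟩
      sum (f ⊕ h ⊕ δ v ⊕ δ w)            ≡⟨ sum-cong-≗ part ⟩
      sum {n} 𝟙                          ≡⟨ trans (sum-𝟙 n) n≡ ⟩
      suc (K + K)                        ∎)
      where open ≡-Reasoning

    E-value : E ≡ 2 * (C + (p + s) + (p′ + s′ + g v w))
    E-value = begin
      E
        ≡⟨ bilinear-cong g (λ i → sym (part i)) (λ i → sym (part i)) ⟩
      pairs (f ⊕ h ⊕ δ v ⊕ δ w) (f ⊕ h ⊕ δ v ⊕ δ w)
        ≡⟨ pairs-⊕δ (f ⊕ h ⊕ δ v) w ⟩
      pairs (f ⊕ h ⊕ δ v) (f ⊕ h ⊕ δ v) + 2 * deg (f ⊕ h ⊕ δ v) w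
        ≡⟨ cong₂ (λ x y → x + 2 * y) (pairs-⊕δ (f ⊕ h) v)
             (trans (deg-⊕ (f ⊕ h) (δ v) w) (cong₂ _+_ (deg-⊕ f h w) (deg-δ v w))) ⟩
      pairs (f ⊕ h) (f ⊕ h) + 2 * deg (f ⊕ h) v + 2 * (p′ + s′ + g v w)
        ≡⟨ cong₂ (λ x y → x + 2 * y + 2 * (p′ + s′ + g v w)) (pairs-⊕ f h) (deg-⊕ f h v) ⟩
      pairs f f + 2 * C + pairs h h + 2 * (p + s) + 2 * (p′ + s′ + g v w)
        ≡⟨ cong₂ (λ x y → x + 2 * C + y + 2 * (p + s) + 2 * (p′ + s′ + g v w)) f-indep h-indep ⟩
      0 + 2 * C + 0 + 2 * (p + s) + 2 * (p′ + s′ + g v w)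
        ≡⟨ identity C (p + s) (p′ + s′ + g v w) ⟩
      2 * (C + (p + s) + (p′ + s′ + g v w)) ∎
      where
      open ≡-Reasoning
      identity : ∀ x y z → 0 + 2 * x + 0 + 2 * y + 2 * z ≡ 2 * (x + y + z)
      identity = solve-∀

    -- inclusion–exclusion for the two rectangles N(v) and N(w), which contain no crossing edge
    crossing : C + p * s + p′ * s′ ≤ sum f * sum h + a * b
    crossing = begin
      C + p * s + p′ * s′
        ≡⟨ cong₂ (λ x y → C + x + y) (sym (bilinear-product (λ i → g i v) (λ j → g j v) f h))
             (sym (bilinear-product (λ i → g i w) (λ j → g j w) f h)) ⟩
      C + bilinear (λ i j → g i v * g j v) f h + bilinear (λ i j → g i w * g j w) f h
        ≡⟨ cong (_+ bilinear (λ i j → g i w * g j w) f h) (sym (bilinear-⊕ᴹ g (λ i j → g i v * g j v) f h)) ⟩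
      bilinear (λ i j → g i j + g i v * g j v) f h + bilinear (λ i j → g i w * g j w) f h
        ≡⟨ sym (bilinear-⊕ᴹ (λ i j → g i j + g i v * g j v) (λ i j → g i w * g j w) f h) ⟩
      bilinear (λ i j → g i j + g i v * g j v + g i w * g j w) f h
        ≤⟨ bilinear-mono {f = f} {f} {h} {h} (λ i j → two-rectangles i j v w) (λ _ → ≤-refl) (λ _ → ≤-refl) ⟩
      bilinear (λ i j → 1 + (g i v * g i w) * (g j v * g j w)) f h
        ≡⟨ bilinear-⊕ᴹ (λ _ _ → 1) (λ i j → (g i v * g i w) * (g j v * g j w)) f h ⟩
      bilinear (λ _ _ → 1) f h + bilinear (λ i j → (g i v * g i w) * (g j v * g j w)) f h
        ≡⟨ cong₂ _+_ (bilinear-1 f h) (bilinear-product (λ i → g i v * g i w) (λ j → g j v * g j w) f h) ⟩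
      sum f * sum h + a * b ∎
      where open ≤-Reasoning

    -- Since p + s - ps = 1 - (p-1)(s-1), this is ω + ab ≤ (p-1)(s-1) + (p′-1)(s′-1) + 2 with ω =
    -- `g v w`. If `v` and `w` are adjacent they have no common neighbour, so the left side is 1;
    -- otherwise `ab-bound` applies.
    defect : g v w + (p + s) + (p′ + s′) + a * b ≤ p * s + p′ * s′ + 4
    defect = shifted p s p′ s′ a b (g v w) 1≤p 1≤s 1≤p′ 1≤s′ (common≤ˡ f v w) (common≤ʳ f v w) (common≤ˡ h v w) (common≤ʳ h v w)
        a? b? edge
      where
      edge : g v w ≡ 0 ⊎ (g v w ≡ 1 × a ≡ 0)
      edge with adj G v w in vw
      ... | false = inj₁ refl
      ... | true  = inj₂ (refl , adjacent⇒common≡0 f v w vw)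
      excess : ∀ {x y} → 3 ≤ suc x + suc y → 1 ≤ x + y
      excess {x} {y} 3≤ = ≤-pred (subst (2 ≤_) (+-suc x y) (≤-pred 3≤))
      identity : ∀ ω P S P′ S′ ab → ω + (suc P + suc S) + (suc P′ + suc S′) + ab + (P * S + P′ * S′ + 2) + 0
        ≡ suc P * suc S + suc P′ * suc S′ + 4 + (ω + ab)
      identity = solve-∀
      shifted : ∀ p s p′ s′ a b ω → 1 ≤ p → 1 ≤ s → 1 ≤ p′ → 1 ≤ s′ → a ≤ p → a ≤ p′ → b ≤ s → b ≤ s′ →
        a ≡ 0 ⊎ 3 ≤ p + p′ → b ≡ 0 ⊎ 3 ≤ s + s′ → ω ≡ 0 ⊎ (ω ≡ 1 × a ≡ 0) →
        ω + (p + s) + (p′ + s′) + a * b ≤ p * s + p′ * s′ + 4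
      shifted (suc P) (suc S) (suc P′) (suc S′) a b ω _ _ _ _ a≤ a≤′ b≤ b≤′ a? b? (inj₁ refl) =
        ≤-by 0 (ab-bound P S P′ S′ a b a≤ a≤′ b≤ b≤′ (map₂ excess a?) (map₂ excess b?))
          (identity 0 P S P′ S′ (a * b))
      shifted (suc P) (suc S) (suc P′) (suc S′) a b ω _ _ _ _ a≤ a≤′ b≤ b≤′ a? b? (inj₂ (refl , refl)) =
        ≤-by 0 (≤-trans (n≤1+n 1) (m≤n+m 2 (P * S + P′ * S′))) (identity 1 P S P′ S′ 0)

    few : E + 2 * K ≤ 2 * (K * K) + 8
    few = subst (λ e → e + 2 * K ≤ 2 * (K * K) + 8) (sym E-value)
      (≤-by 0 (*-monoʳ-≤ 2 (+-mono-≤ (+-mono-≤ crossing defect) (split-product (sum f) (sum h) K size)))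
        (identity C (p + s) (p′ + s′) (g v w) K (K * K) (p * s) (p′ * s′) (a * b) (sum f * sum h)))
      where
      identity : ∀ C x y ω K K² r r′ ab fh →
        2 * (C + x + (y + ω)) + 2 * K + 2 * (fh + ab + (r + r′ + 4) + K²) + 0
        ≡ 2 * K² + 8 + 2 * (C + r + r′ + (ω + x + y + ab) + (fh + K))
      identity = solve-∀

  -- Neighbourhoods and the choice of the case

  private
    N : Fin n → Weight n
    N v i = g i v

    N-indep : ∀ v → Indep (N v)
    N-indep v = sum-zero λ j → trans (*-distribˡ-sum (g j v) (λ i → g i v * g i j)) (sum-zero (vanish j))
      where
      vanish : ∀ j i → g j v * (g i v * g i j) ≡ 0
      vanish j i with adj G j v in jv | adj G i v in iv
      ... | false | _     = refl
      ... | true  | false = refl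
      ... | true  | true rewrite tf i j v iv jv = refl

    N-disjoint : ∀ {x y} → adj G x y ≡ true → ∀ i → N x i + N y i ≤ 1
    N-disjoint {x} {y} xy i with adj G i x in ix | adj G i y in iy
    ... | false | _     = ι≤1 _
    ... | true  | false = ≤-refl
    ... | true  | true with () ← trans (sym ix) (tf i x y iy xy)

  dense-edge : ∀ {x y} → adj G x y ≡ true → n ≤ sum (N x) + sum (N y) + 2 → NearBipartite ⊎ TwoDefects
  dense-edge {x} {y} xy dense = by-size (sum r) refl
    where
    r : Weight n
    r i = 1 ∸ (N x i + N y i)

    covered : ∀ i → (N x ⊕ N y ⊕ r) i ≡ 1
    covered i = m+[n∸m]≡n (N-disjoint xy i)

    size : sum (N x) + sum (N y) + sum r ≡ n
    size = trans (cong (_+ sum r) (sym (∑-distrib-+ (N x) (N y))))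
      (trans (sym (∑-distrib-+ (N x ⊕ N y) r)) (trans (sum-cong-≗ covered) (sum-𝟙 n)))

    sum-r≤2 : sum r ≤ 2
    sum-r≤2 = +-cancelˡ-≤ (sum (N x) + sum (N y)) _ 2 (≤-trans (≤-reflexive size) dense)

    pick : ∀ (f : Weight n) m → sum f ≡ suc m → ∃ λ v → ∃ λ f′ → (∀ i → f i ≡ (f′ ⊕ δ v) i) × sum f′ ≡ m
    pick f m eq with v , 1≤fv ← sum-positive {f = f} (subst (1 ≤_) (sym eq) (s≤s z≤n))
      with f′ , f≡ ← remove f v 1≤fv
      = v , f′ , f≡ , suc-injective (trans (+-comm 1 (sum f′)) (trans (cong (sum f′ +_) (sym (sum-δ v)))
          (trans (sym (∑-distrib-+ f′ (δ v))) (trans (sum-cong-≗ (λ i → sym (f≡ i))) eq))))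

    by-size : ∀ m → sum r ≡ m → NearBipartite ⊎ TwoDefects
    -- Nothing is missing, yet `NearBipartite` asks for an exceptional vertex: `x` is taken out of
    -- `N y`, where it lies because `x` and `y` are adjacent.
    by-size 0 r≡0 with h′ , h≡ ← remove (N y) x (≤-reflexive (sym (cong ι xy))) = inj₁ record
      { f = N x ; h = h′ ; z = x ; f-indep = N-indep x
      ; h-indep = Indep-≤ (N y) h′ (λ i → subst (h′ i ≤_) (sym (h≡ i)) (m≤m+n (h′ i) (δ x i))) (N-indep y)
      ; part = λ i → begin
          N x i + h′ i + δ x i    ≡⟨ +-assoc (N x i) (h′ i) (δ x i) ⟩
          N x i + (h′ i + δ x i)  ≡⟨ cong (N x i +_) (sym (h≡ i)) ⟩
          N x i + N y i           ≡⟨ sym (+-identityʳ _) ⟩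
          N x i + N y i + 0       ≡⟨ cong (N x i + N y i +_) (sym (sum≡0⇒≡0 {f = r} r≡0 i)) ⟩
          N x i + N y i + r i     ≡⟨ covered i ⟩
          1                       ∎ }
      where open ≡-Reasoning
    by-size 1 r≡1 with v , r′ , r≡ , r′≡0 ← pick r 0 r≡1 = inj₁ record
      { f = N x ; h = N y ; z = v ; f-indep = N-indep x ; h-indep = N-indep y
      ; part = λ i → trans (cong (N x i + N y i +_)
          (sym (trans (r≡ i) (cong (_+ δ v i) (sum≡0⇒≡0 {f = r′} r′≡0 i))))) (covered i) }
    by-size 2 r≡2 with w , r′ , r≡ , r′≡1 ← pick r 1 r≡2 with v , r″ , r′≡ , r″≡0 ← pick r′ 0 r′≡1 = inj₂ record
      { f = N x ; h = N y ; v = v ; w = w ; f-indep = N-indep x ; h-indep = N-indep y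
      ; part = λ i → trans (+-assoc (N x i + N y i) (δ v i) (δ w i)) (trans (cong (N x i + N y i +_)
          (sym (trans (r≡ i) (cong (_+ δ w i) (trans (r′≡ i) (cong (_+ δ v i) (sum≡0⇒≡0 {f = r″} r″≡0 i)))))))
          (covered i)) }
    by-size (suc (suc (suc m))) r≡ with s≤s (s≤s ()) ← subst (_≤ 2) r≡ sum-r≤2

  -- A neighbour of `x` has degree at most n - 3 - D, any other vertex at most D, hence E ≤ D(2n - 3
  -- - 2D). The indicator `N x u` merges both cases into one inequality without subtraction, which
  -- is then summed over `u`.
  sparse-neighbourhood : ∀ {K} x → n ≡ suc (K + K) → (∀ i → sum (N i) ≤ sum (N x)) →
    (∀ y → adj G x y ≡ true → sum (N x) + sum (N y) + 3 ≤ n) → E + K ≤ 2 * (K * K)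
  sparse-neighbourhood {K} x n≡ max light = degree-optimum E D K (begin
    E + D * (D + D + 3)
      ≡⟨ cong₂ _+_ E≡ (*-distribʳ-sum (D + D + 3) (N x)) ⟩
    ∑[ u < n ] sum (N u) + ∑[ u < n ] (N x u * (D + D + 3))
      ≡⟨ sym (∑-distrib-+ (λ u → sum (N u)) (λ u → N x u * (D + D + 3))) ⟩
    ∑[ u < n ] (sum (N u) + N x u * (D + D + 3))
      ≤⟨ sum-mono pointwise ⟩
    ∑[ u < n ] (N x u * n + 1 * D)
      ≡⟨ ∑-distrib-+ (λ u → N x u * n) (λ _ → 1 * D) ⟩
    ∑[ u < n ] (N x u * n) + ∑[ u < n ] (1 * D)
      ≡⟨ cong₂ _+_ (sym (*-distribʳ-sum n (N x))) (trans (sym (*-distribʳ-sum {n} D 𝟙)) (cong (_* D) (sum-𝟙 n))) ⟩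
    D * n + n * D
      ≡⟨ cong (λ m → D * m + m * D) n≡ ⟩
    D * suc (K + K) + suc (K + K) * D ∎)
    where
    open ≤-Reasoning
    D = sum (N x)
    E≡ : E ≡ ∑[ u < n ] sum (N u)
    E≡ = sum-cong-≗ λ u → trans (*-identityˡ _) (sum-cong-≗ λ i → *-identityˡ (g i u))
    pointwise : ∀ u → sum (N u) + N x u * (D + D + 3) ≤ N x u * n + 1 * D
    pointwise u with adj G u x in ux
    ... | false = ≤-trans (≤-reflexive (+-identityʳ _)) (≤-trans (max u) (≤-reflexive (sym (+-identityʳ D))))
    ... | true  = ≤-by 0 (light u (trans (Graph.sym G x u) ux)) (identity (sum (N u)) D n)
      where
      identity : ∀ d D n → d + 1 * (D + D + 3) + n + 0 ≡ 1 * n + 1 * D + (D + d + 3)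
      identity = solve-∀

  dichotomy : ∀ {K} → n ≡ suc (K + K) → Dichotomy K
  dichotomy {K} refl with x , max ← argmax (λ v → sum (N v))
    with any? (λ y → (adj G x y Bool.≟ true) ×-dec (suc (K + K) ≤? sum (N x) + sum (N y) + 2))
  ... | no none = sparse (sparse-neighbourhood x refl max λ y xy →
          subst (_≤ suc (K + K)) (sym (+-suc _ 2)) (≰⇒> λ dense → none (y , xy , dense)))
  ... | yes (y , xy , dense) with dense-edge xy dense
  ... | inj₁ nb = nearBipartite-dichotomy refl nb
  ... | inj₂ td with twoDefects-sparse {K = K} refl td
  ... | inj₁ nb = nearBipartite-dichotomy refl nb
  ... | inj₂ le = sparse′ le

-- Complements and induced subgraphs

complement : Graph n → Graph n
complement H = record
  { adj    = λ i j → not (adj H i j) ∧ not (does (i ≟ j))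
  ; sym    = λ i j → cong₂ (λ a b → not a ∧ not b) (Graph.sym H i j) (does-≟-sym i j)
  ; irrefl = λ i → trans (cong (λ b → not (adj H i i) ∧ not b) (dec-true (i ≟ i) refl)) (∧-zeroʳ _)
  }
  where
  does-≟-sym : (i j : Fin n) → does (i ≟ j) ≡ does (j ≟ i)
  does-≟-sym i j with i ≟ j | j ≟ i
  ... | yes _   | yes _   = refl
  ... | yes i≡j | no j≢i  = ⊥-elim (j≢i (sym i≡j))
  ... | no i≢j  | yes j≡i = ⊥-elim (i≢j (sym j≡i))
  ... | no _    | no _    = refl

δ-does : (u i : Fin n) → δ u i ≡ ι (does (u ≟ i))
δ-does zero    zero    = refl
δ-does zero    (suc i) = refl
δ-does (suc u) zero    = refl
δ-does (suc u) (suc i) = δ-does u i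

∣tabulate∣ : (s : Fin n → Bool) → ∣ tabulate s ∣ ≡ ∑[ i < n ] ι (s i)
∣tabulate∣ {zero}  s = refl
∣tabulate∣ {suc n} s with s zero
... | true  = cong suc (∣tabulate∣ (λ i → s (suc i)))
... | false = ∣tabulate∣ (λ i → s (suc i))

∈-tabulate⁺ : (s : Fin n → Bool) {i : Fin n} → s i ≡ true → i ∈ tabulate s
∈-tabulate⁺ s {i} si = lookup⇒[]= i (tabulate s) (trans (lookup∘tabulate s i) si)

∈-tabulate⁻ : (s : Fin n → Bool) {i : Fin n} → i ∈ tabulate s → s i ≡ true
∈-tabulate⁻ s {i} i∈ = trans (sym (lookup∘tabulate s i)) ([]=⇒lookup i∈)

-- A triangle of the complement is an independent set of three vertices in `H`; its edges also make
-- the three vertices distinct, which gives `size`.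
complement-triangleFree : (H : Graph n) → IndepNumberAtMost H 2 → TriangleFree (complement H)
complement-triangleFree {n} H α≤2 i j l il jl with adj (complement H) i j in ij
... | false = refl
... | true  = ⊥-elim (1+n≰n (subst (_≤ 2) size (α≤2 (tabulate s) indep)))
  where
  nonadjacent : ∀ {a b} → adj (complement H) a b ≡ true → adj H a b ≡ false × a ≢ b
  nonadjacent {a} {b} ab with adj H a b | a ≟ b
  ... | false | no a≢b = refl , a≢b

  s : Fin n → Bool
  s a = does (i ≟ a) ∨ does (j ≟ a) ∨ does (l ≟ a)

  ι-s : ∀ a → ι (s a) ≡ (δ i ⊕ δ j ⊕ δ l) a
  ι-s a rewrite δ-does i a | δ-does j a | δ-does l a with i ≟ a | j ≟ a | l ≟ a
  ... | yes i≡a | yes j≡a | _       = ⊥-elim (proj₂ (nonadjacent ij) (trans i≡a (sym j≡a)))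
  ... | yes i≡a | no _    | yes l≡a = ⊥-elim (proj₂ (nonadjacent il) (trans i≡a (sym l≡a)))
  ... | yes _   | no _    | no _    = refl
  ... | no _    | yes j≡a | yes l≡a = ⊥-elim (proj₂ (nonadjacent jl) (trans j≡a (sym l≡a)))
  ... | no _    | yes _   | no _    = refl
  ... | no _    | no _    | yes _   = refl
  ... | no _    | no _    | no _    = refl

  size : ∣ tabulate s ∣ ≡ 3
  size = begin
    ∣ tabulate s ∣                      ≡⟨ ∣tabulate∣ s ⟩
    ∑[ a < n ] ι (s a)                  ≡⟨ sum-cong-≗ ι-s ⟩
    sum (δ i ⊕ δ j ⊕ δ l)               ≡⟨ ∑-distrib-+ (δ i ⊕ δ j) (δ l) ⟩
    sum (δ i ⊕ δ j) + sum (δ l)         ≡⟨ cong₂ _+_ (∑-distrib-+ (δ i) (δ j)) (sum-δ l) ⟩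
    sum (δ i) + sum (δ j) + 1           ≡⟨ cong₂ (λ x y → x + y + 1) (sum-δ i) (sum-δ j) ⟩
    3                                   ∎
    where open ≡-Reasoning

  member : ∀ a → s a ≡ true → i ≡ a ⊎ j ≡ a ⊎ l ≡ a
  member a sa with i ≟ a | j ≟ a | l ≟ a
  ... | yes i≡a | _       | _       = inj₁ i≡a
  ... | no _    | yes j≡a | _       = inj₂ (inj₁ j≡a)
  ... | no _    | no _    | yes l≡a = inj₂ (inj₂ l≡a)

  indep : Independent H (tabulate s)
  indep a b a∈ b∈ with member a (∈-tabulate⁻ s a∈) | member b (∈-tabulate⁻ s b∈)
  ... | inj₁ refl        | inj₁ refl        = irrefl H i
  ... | inj₁ refl        | inj₂ (inj₁ refl) = proj₁ (nonadjacent ij)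
  ... | inj₁ refl        | inj₂ (inj₂ refl) = proj₁ (nonadjacent il)
  ... | inj₂ (inj₁ refl) | inj₁ refl        = trans (Graph.sym H j i) (proj₁ (nonadjacent ij))
  ... | inj₂ (inj₁ refl) | inj₂ (inj₁ refl) = irrefl H j
  ... | inj₂ (inj₁ refl) | inj₂ (inj₂ refl) = proj₁ (nonadjacent jl)
  ... | inj₂ (inj₂ refl) | inj₁ refl        = trans (Graph.sym H l i) (proj₁ (nonadjacent il))
  ... | inj₂ (inj₂ refl) | inj₂ (inj₁ refl) = trans (Graph.sym H l j) (proj₁ (nonadjacent jl))
  ... | inj₂ (inj₂ refl) | inj₂ (inj₂ refl) = irrefl H l

sum-allFin : (f : Fin n → ℕ) → ListAction.sum (map f (allFin n)) ≡ sum f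
sum-allFin f = trans (cong ListAction.sum (map-tabulate (λ i → i) f)) (sum-tabulate f)
  where
  sum-tabulate : ∀ {n} (f : Fin n → ℕ) → ListAction.sum (List.tabulate f) ≡ sum f
  sum-tabulate {zero}  f = refl
  sum-tabulate {suc n} f = cong (f zero +_) (sum-tabulate (λ i → f (suc i)))

-- Adding the sum over i < j to its transpose counts each pair of distinct vertices in both orders;
-- irreflexivity settles the diagonal.
pairCount-double : (R : Fin n → Fin n → Bool) → (∀ i j → R i j ≡ R j i) → (∀ i → R i i ≡ false) →
  2 * pairCount R ≡ ∑[ j < n ] ∑[ i < n ] ι (R i j)
pairCount-double {n} R R-sym R-irrefl = begin
  2 * pairCount R
    ≡⟨ cong (2 *_) (trans (sum-allFin (λ i → ListAction.sum (map (ordered i) (allFin n)))) (sum-cong-≗ λ i → sum-allFin (λ j → ordered i j))) ⟩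
  2 * ∑[ i < n ] ∑[ j < n ] ordered i j
    ≡⟨ cong (∑[ i < n ] ∑[ j < n ] ordered i j +_) (+-identityʳ _) ⟩
  ∑[ i < n ] ∑[ j < n ] ordered i j + ∑[ i < n ] ∑[ j < n ] ordered i j
    ≡⟨ cong (_+ ∑[ i < n ] ∑[ j < n ] ordered i j) (∑-comm ordered) ⟩
  ∑[ j < n ] ∑[ i < n ] ordered i j + ∑[ i < n ] ∑[ j < n ] ordered i j
    ≡⟨ sym (∑-distrib-+ (λ j → ∑[ i < n ] ordered i j) (λ j → ∑[ i < n ] ordered j i)) ⟩
  ∑[ j < n ] (∑[ i < n ] ordered i j + ∑[ i < n ] ordered j i)
    ≡⟨ sum-cong-≗ (λ j → trans (sym (∑-distrib-+ (λ i → ordered i j) (λ i → ordered j i))) (sum-cong-≗ λ i → both i j)) ⟩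
  ∑[ j < n ] ∑[ i < n ] ι (R i j) ∎
  where
  open ≡-Reasoning
  ordered : Fin n → Fin n → ℕ
  ordered i j = if (toℕ i <ᵇ toℕ j) ∧ R i j then 1 else 0

  exclusive : ∀ a b x → a ≢ b → ι ((a <ᵇ b) ∧ x) + ι ((b <ᵇ a) ∧ x) ≡ ι x
  exclusive zero    zero    x a≢b = ⊥-elim (a≢b refl)
  exclusive zero    (suc b) x _   = +-identityʳ _
  exclusive (suc a) zero    x _   = refl
  exclusive (suc a) (suc b) x a≢b = exclusive a b x (λ a≡b → a≢b (cong suc a≡b))

  both : ∀ i j → ordered i j + ordered j i ≡ ι (R i j)
  both i j with i ≟ j
  ... | no i≢j rewrite R-sym j i = exclusive (toℕ i) (toℕ j) (R i j) (λ eq → i≢j (toℕ-injective eq))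
  ... | yes refl rewrite R-irrefl i | ∧-zeroʳ (toℕ i <ᵇ toℕ i) = refl

induced : (H : Graph n) → (Fin n → Bool) → Subgraph H
induced H s = record
  { verts   = tabulate s
  ; sedge   = λ i j → adj H i j ∧ (s i ∧ s j)
  ; ssym    = λ i j → cong₂ _∧_ (Graph.sym H i j) (∧-comm (s i) (s j))
  ; sub     = λ i j → proj₁ ∘ split
  ; inVerts = λ i j e → let si∧sj = proj₂ (split {adj H i j} e) in
      ∈-tabulate⁺ s (proj₁ (split si∧sj)) , ∈-tabulate⁺ s (proj₂ (split {s i} si∧sj))
  }
  where
  split : ∀ {a b} → a ∧ b ≡ true → a ≡ true × b ≡ true
  split {true} b≡true = refl , b≡true

-- The ordered pairs of chosen vertices split into edges of `H`, edges of the complement, and the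
-- diagonal, for which `δ` serves as the identity matrix.
induced-edges : (H : Graph n) (s : Fin n → Bool) (let σ = λ i → ι (s i)) →
  2 * pairCount (sedge (induced H s)) + Counting.pairs (complement H) σ σ + sum σ ≡ sum σ * sum σ
induced-edges {n} H s = begin
  2 * pairCount (sedge (induced H s)) + pairs σ σ + sum σ
    ≡⟨ cong₂ (λ a b → a + pairs σ σ + b) H-pairs diagonal ⟩
  bilinear h σ σ + pairs σ σ + bilinear δ σ σ
    ≡⟨ cong (_+ bilinear δ σ σ) (sym (bilinear-⊕ᴹ h g σ σ)) ⟩
  bilinear (λ i j → h i j + g i j) σ σ + bilinear δ σ σ
    ≡⟨ sym (bilinear-⊕ᴹ (λ i j → h i j + g i j) δ σ σ) ⟩
  bilinear (λ i j → h i j + g i j + δ i j) σ σ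
    ≡⟨ sum-cong-≗ (λ j → cong (σ j *_) (sum-cong-≗ λ i → cong (σ i *_) (all-pairs i j))) ⟩
  bilinear (λ _ _ → 1) σ σ
    ≡⟨ bilinear-1 σ σ ⟩
  sum σ * sum σ ∎
  where
  open ≡-Reasoning
  open Counting (complement H)
  σ : Weight n
  σ i = ι (s i)
  h : Fin n → Fin n → ℕ
  h i j = ι (adj H i j)

  all-pairs : ∀ i j → h i j + g i j + δ i j ≡ 1
  all-pairs i j rewrite δ-does i j with i ≟ j
  ... | yes refl rewrite irrefl H i = refl
  ... | no _ with adj H i j
  ... | true  = refl
  ... | false = refl

  δ-comm : ∀ {n} (i j : Fin n) → δ i j ≡ δ j i
  δ-comm zero    zero    = refl
  δ-comm zero    (suc j) = refl
  δ-comm (suc i) zero    = refl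
  δ-comm (suc i) (suc j) = δ-comm i j

  diagonal : sum σ ≡ bilinear δ σ σ
  diagonal = sum-cong-≗ λ j → sym (trans
    (cong (σ j *_) (trans (sum-cong-≗ λ i → trans (*-comm (σ i) (δ i j)) (cong (_* σ i) (δ-comm i j))) (sum-δ* j σ)))
    (idempotent (s j)))
    where
    idempotent : ∀ b → ι b * ι b ≡ ι b
    idempotent true  = refl
    idempotent false = refl

  H-pairs : 2 * pairCount (sedge (induced H s)) ≡ bilinear h σ σ
  H-pairs = trans
    (pairCount-double (sedge (induced H s)) (ssym (induced H s)) (λ i → cong (_∧ (s i ∧ s i)) (irrefl H i)))
    (sum-cong-≗ λ j → trans (sum-cong-≗ λ i → product (adj H i j) (s i) (s j))
      (sym (*-distribˡ-sum (σ j) (λ i → σ i * h i j))))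
    where
    product : ∀ a b c → ι (a ∧ (b ∧ c)) ≡ ι c * (ι b * ι a)
    product true  true  true  = refl
    product true  true  false = refl
    product true  false true  = refl
    product true  false false = refl
    product false true  true  = refl
    product false true  false = refl
    product false false true  = refl
    product false false false = refl

-- Any set of `S` vertices bounds the 2-density from below through its induced subgraph, `P` being
-- the number of edges there. Writing `P` as `suc x` turns the integer numerator P - 1 into the
-- natural number `x`.
m2-≥ : (H : Graph n) {q : ℚ} → IsM2 H q → (f : Weight n) → (∀ i → f i ≤ 1) →
  ∀ {S} → 3 ≤ S → sum f ≡ S →
  ∃ λ P → 2 * P + Counting.pairs (complement H) f f + S ≡ S * S
        × (∀ x → P ≡ suc x → ratio (ℤ.+ x) (S ∸ 2) ℚ.≤ q)
m2-≥ {n} H {q} (_ , maximal) f f≤1 {S} 3≤S size = pairCount (sedge H′) , edge-count , density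
  where
  open Counting (complement H)
  s : Fin n → Bool
  s i = 0 <ᵇ f i
  H′ = induced H s
  σ : Weight n
  σ i = ι (s i)
  σ≡f : ∀ i → σ i ≡ f i
  σ≡f i with f i | f≤1 i
  ... | zero  | _       = refl
  ... | suc _ | s≤s z≤n = refl
  size′ : sum σ ≡ S
  size′ = trans (sum-cong-≗ σ≡f) size
  order : ∣ verts H′ ∣ ≡ S
  order = trans (∣tabulate∣ s) size′
  edge-count : 2 * pairCount (sedge H′) + pairs f f + S ≡ S * S
  edge-count = subst (λ z → 2 * pairCount (sedge H′) + pairs f f + z ≡ z * z) size′
    (subst (λ p → 2 * pairCount (sedge H′) + p + sum σ ≡ sum σ * sum σ) (bilinear-cong g σ≡f σ≡f) (induced-edges H s))
  density : ∀ x → pairCount (sedge H′) ≡ suc x → ratio (ℤ.+ x) (S ∸ 2) ℚ.≤ q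
  density x P≡ = subst (ℚ._≤ q) (cong₂ (λ p o → ratio (ℤ.+ p ℤ.- ℤ.+ 1) (o ∸ 2)) P≡ order)
    (maximal H′ (subst (3 ≤_) (sym order) 3≤S))

-- From edge counts to the rational bound

maxOver-≥ : (f : ℕ → ℚ) (m t : ℕ) → t < m → f (suc t) ℚ.≤ maxOver f m
maxOver-≥ f (suc zero)    zero t<m = ℚ.≤-refl
maxOver-≥ f (suc zero)    (suc t) (s≤s ())
maxOver-≥ f (suc (suc m)) t (s≤s t≤) =
  [ (λ t< → ℚ.≤-trans (maxOver-≥ f (suc m) t t<) (ℚ.p≤p⊔q _ _))
  , (λ { refl → ℚ.p≤q⊔p (maxOver f (suc m)) (f (suc (suc m))) })
  ]′ (m≤n⇒m<n∨m≡n t≤)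

private
  frac : ∀ a b → ℚ.toℚᵘ ((ℤ.+ a) ℚ./ suc b) ≃ᵘ mkℚᵘ (ℤ.+ a) b
  frac a b = ℚ.toℚᵘ-fromℚᵘ (mkℚᵘ (ℤ.+ a) b)

  p-r≤q : ∀ {p r y q} → p ℚ.≤ y ℚ.+ r → y ℚ.≤ q → p ℚ.- r ℚ.≤ q
  p-r≤q {p} {r} {y} {q} p≤ y≤q = begin
    p ℚ.- r          ≤⟨ ℚ.+-monoˡ-≤ (ℚ.- r) p≤ ⟩
    y ℚ.+ r ℚ.- r    ≡⟨ ℚ.+-assoc y r (ℚ.- r) ⟩
    y ℚ.+ (r ℚ.- r)  ≡⟨ cong (y ℚ.+_) (ℚ.+-inverseʳ r) ⟩
    y ℚ.+ ℚ.0ℚ       ≡⟨ ℚ.+-identityʳ y ⟩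
    y                ≤⟨ y≤q ⟩
    q                ∎
    where open ℚ.≤-Reasoning

-- The last hypothesis is a/2 ≤ x/D + t/d with denominators cleared. `D` stays free because the
-- density may come from a k-set (`d`) or from the whole graph (`M`).
first-loss : ∀ a d t x D {q} → 1 ≤ d → 1 ≤ D → ratio (ℤ.+ x) D ℚ.≤ q →
  a * (D * d) ≤ (x * d + t * D) * 2 → ratio (ℤ.+ a) 2 ℚ.- ratio (ℤ.+ t) d ℚ.≤ q
first-loss a (suc c) t x (suc m) _ _ x≤q le = p-r≤q {y = (ℤ.+ x) ℚ./ suc m} (ℚ.toℚᵘ-cancel-≤ (begin
  ℚ.toℚᵘ ((ℤ.+ a) ℚ./ 2)             ≃⟨ frac a 1 ⟩
  mkℚᵘ (ℤ.+ a) 1                     ≤⟨ *≤* (subst₂ ℤ._≤_ lhs rhs (ℤ.+≤+ le)) ⟩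
  mkℚᵘ (ℤ.+ x) m ℚᵘ.+ mkℚᵘ (ℤ.+ t) c   ≃⟨ ℚᵘ.+-cong (frac x m) (frac t c) ⟨
  ℚ.toℚᵘ ((ℤ.+ x) ℚ./ suc m) ℚᵘ.+ ℚ.toℚᵘ ((ℤ.+ t) ℚ./ suc c)
                                   ≃⟨ ℚ.toℚᵘ-homo-+ ((ℤ.+ x) ℚ./ suc m) ((ℤ.+ t) ℚ./ suc c) ⟨
  ℚ.toℚᵘ ((ℤ.+ x) ℚ./ suc m ℚ.+ (ℤ.+ t) ℚ./ suc c) ∎)) x≤q
  where
  open ℚᵘ.≤-Reasoning
  lhs : ℤ.+ (a * (suc m * suc c)) ≡ ℤ.+ a ℤ.* ℤ.+ (suc m * suc c)
  lhs = ℤ.pos-* a (suc m * suc c)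
  rhs : ℤ.+ ((x * suc c + t * suc m) * 2) ≡ (ℤ.+ x ℤ.* ℤ.+ suc c ℤ.+ ℤ.+ t ℤ.* ℤ.+ suc m) ℤ.* ℤ.+ 2
  rhs = trans (ℤ.pos-* (x * suc c + t * suc m) 2) (cong (ℤ._* ℤ.+ 2)
    (cong₂ ℤ._+_ (ℤ.pos-* x (suc c)) (ℤ.pos-* t (suc m))))

-- The last hypothesis is a/2 + s/M ≤ x/D + (a/2)/M multiplied by 2MD, a form without subtraction.
second-loss : ∀ a M s x D {q} → 1 ≤ M → 1 ≤ D → ratio (ℤ.+ x) D ℚ.≤ q →
  (a * M + s * 2) * D ≤ x * 2 * M + a * D →
  ratio (ℤ.+ a) 2 ℚ.- (ratio (ℤ.+ a) 2 ℚ.- ratio (ℤ.+ s) 1) ℚ.* ratio (ℤ.+ 1) M ℚ.≤ q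
second-loss a (suc b) s x (suc m) {q} _ _ x≤q le = subst (ℚ._≤ q) (sym (expand X S R)) (p-r≤q {y = Y} (ℚ.toℚᵘ-cancel-≤ (begin
  ℚ.toℚᵘ (X ℚ.+ S ℚ.* R)
    ≃⟨ ℚ.toℚᵘ-homo-+ X (S ℚ.* R) ⟩
  ℚ.toℚᵘ X ℚᵘ.+ ℚ.toℚᵘ (S ℚ.* R)
    ≃⟨ ℚᵘ.+-cong (frac a 1) (ℚᵘ.≃-trans (ℚ.toℚᵘ-homo-* S R) (ℚᵘ.*-cong (frac s 0) (frac 1 b))) ⟩
  mkℚᵘ (ℤ.+ a) 1 ℚᵘ.+ mkℚᵘ (ℤ.+ s) 0 ℚᵘ.* mkℚᵘ (ℤ.+ 1) b
    ≤⟨ *≤* (subst₂ ℤ._≤_ lhs rhs (ℤ.+≤+ scaled)) ⟩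
  mkℚᵘ (ℤ.+ x) m ℚᵘ.+ mkℚᵘ (ℤ.+ a) 1 ℚᵘ.* mkℚᵘ (ℤ.+ 1) b
    ≃⟨ ℚᵘ.+-cong (frac x m) (ℚᵘ.≃-trans (ℚ.toℚᵘ-homo-* X R) (ℚᵘ.*-cong (frac a 1) (frac 1 b))) ⟨
  ℚ.toℚᵘ Y ℚᵘ.+ ℚ.toℚᵘ (X ℚ.* R)
    ≃⟨ ℚ.toℚᵘ-homo-+ Y (X ℚ.* R) ⟨
  ℚ.toℚᵘ (Y ℚ.+ X ℚ.* R) ∎)) x≤q)
  where
  open ℚᵘ.≤-Reasoning
  X = (ℤ.+ a) ℚ./ 2
  S = (ℤ.+ s) ℚ./ 1
  R = (ℤ.+ 1) ℚ./ suc b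
  Y = (ℤ.+ x) ℚ./ suc m
  expand : ∀ X S R → X ℚ.- (X ℚ.- S) ℚ.* R ≡ X ℚ.+ S ℚ.* R ℚ.- X ℚ.* R
  expand = +-*-Solver.solve 3 (λ X S R → X :- (X :- S) :* R := X :+ S :* R :- X :* R) refl
    where open +-*-Solver
  -- `B` stands for the argument `M` of the statement, and the local `M` for its `D`.
  -- Cross-multiplying the unnormalised fractions leaves a common factor `2 * B` on both sides.
  B = suc b
  M = suc m
  scaled : (a * (1 * B) + s * 1 * 2) * (M * (2 * B)) ≤ (x * (2 * B) + a * 1 * M) * (2 * (1 * B))
  scaled = subst₂ _≤_ (left a B s M) (right x B a M) (*-monoʳ-≤ (2 * B) le)
    where
    left : ∀ a B s M → 2 * B * ((a * B + s * 2) * M) ≡ (a * (1 * B) + s * 1 * 2) * (M * (2 * B))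
    left = solve-∀
    right : ∀ x B a M → 2 * B * (x * 2 * B + a * M) ≡ (x * (2 * B) + a * 1 * M) * (2 * (1 * B))
    right = solve-∀
  lhs : ℤ.+ ((a * (1 * B) + s * 1 * 2) * (M * (2 * B)))
    ≡ (ℤ.+ a ℤ.* ℤ.+ (1 * B) ℤ.+ ℤ.+ s ℤ.* ℤ.+ 1 ℤ.* ℤ.+ 2) ℤ.* ℤ.+ (M * (2 * B))
  lhs = trans (ℤ.pos-* (a * (1 * B) + s * 1 * 2) (M * (2 * B))) (cong (ℤ._* ℤ.+ (M * (2 * B)))
    (cong₂ ℤ._+_ (ℤ.pos-* a (1 * B)) (trans (ℤ.pos-* (s * 1) 2) (cong (ℤ._* ℤ.+ 2) (ℤ.pos-* s 1)))))
  rhs : ℤ.+ ((x * (2 * B) + a * 1 * M) * (2 * (1 * B)))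
    ≡ (ℤ.+ x ℤ.* ℤ.+ (2 * B) ℤ.+ ℤ.+ a ℤ.* ℤ.+ 1 ℤ.* ℤ.+ M) ℤ.* ℤ.+ (2 * (1 * B))
  rhs = trans (ℤ.pos-* (x * (2 * B) + a * 1 * M) (2 * (1 * B))) (cong (ℤ._* ℤ.+ (2 * (1 * B)))
    (cong₂ ℤ._+_ (ℤ.pos-* x (2 * B)) (trans (ℤ.pos-* (a * 1) M) (cong (ℤ._* ℤ.+ M) (ℤ.pos-* a 1)))))

private
  loss : ℕ → ℕ → ℚ
  loss k t = ratio (ℤ.+ t) (k ∸ 2) ℚ.⊓
    ((ratio (ℤ.+ (k + 1)) 2 ℚ.- ratio (ℤ.+ ((t ∸ 1) ^ 2)) 1) ℚ.* ratio (ℤ.+ 1) (2 * k ∸ 3))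

bound-≤ : ∀ k t {q} → t < k ∸ 2 →
  ratio (ℤ.+ (k + 1)) 2 ℚ.- ratio (ℤ.+ suc t) (k ∸ 2) ℚ.≤ q →
  ratio (ℤ.+ (k + 1)) 2 ℚ.- (ratio (ℤ.+ (k + 1)) 2 ℚ.- ratio (ℤ.+ (t ^ 2)) 1) ℚ.* ratio (ℤ.+ 1) (2 * k ∸ 3) ℚ.≤ q →
  bound k ℚ.≤ q
bound-≤ k t {q} t< first second = ℚ.≤-trans
  (ℚ.+-monoʳ-≤ X (ℚ.neg-antimono-≤ (maxOver-≥ (loss k) (k ∸ 2) t t<)))
  (min-loss (ratio (ℤ.+ suc t) (k ∸ 2)) _ first second)
  where
  X = ratio (ℤ.+ (k + 1)) 2
  min-loss : ∀ u w → X ℚ.- u ℚ.≤ q → X ℚ.- w ℚ.≤ q → X ℚ.- (u ℚ.⊓ w) ℚ.≤ q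
  min-loss u w u≤ w≤ with ℚ.⊓-sel u w
  ... | inj₁ eq = subst (λ m → X ℚ.- m ℚ.≤ q) (sym eq) u≤
  ... | inj₂ eq = subst (λ m → X ℚ.- m ℚ.≤ q) (sym eq) w≤

-- The parameters are k + 1 = a, k - 2 = d, k - 1 = K, 2k - 3 = M and 2k - 1 = N, while P and Q count
-- edges of H. Writing the constants on the right of c keeps products from unfolding.
whole-numbers : ∀ c {a d K M N} E P → a ≡ c + 5 → d ≡ c + 2 → K ≡ c + 3 → M ≡ c + c + 5 → N ≡ c + c + 7 →
  2 * P + E + N ≡ N * N → E + K ≤ 2 * (K * K) ⊎ E + 2 * K ≤ 2 * (K * K) + 8 →
  ∃ λ x → P ≡ suc x × a * (M * d) ≤ (x * d + 1 * M) * 2 × a * M + 0 ≤ x * 2 + a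
-- Without edges in `H`, `E` would be N(N-1), which exceeds both bounds.
whole-numbers c E zero refl refl refl refl refl eq (inj₁ le) =
  ⊥-elim (1+n≰n (≤-by {1} {0} (26 + c * 15 + 2 * (c * c)) (+-mono-≤ (≤-reflexive (sym eq)) le) (identity c E)))
  where
  identity : ∀ c E → 1 + (E + (c + c + 7) + 2 * ((c + 3) * (c + 3))) + (26 + c * 15 + 2 * (c * c))
    ≡ (c + c + 7) * (c + c + 7) + (E + (c + 3))
  identity = solve-∀
whole-numbers c E zero refl refl refl refl refl eq (inj₂ le) =
  ⊥-elim (1+n≰n (≤-by {1} {0} (21 + c * 16 + 2 * (c * c)) (+-mono-≤ (≤-reflexive (sym eq)) le) (identity c E)))
  where
  identity : ∀ c E → 1 + (E + (c + c + 7) + (2 * ((c + 3) * (c + 3)) + 8)) + (21 + c * 16 + 2 * (c * c))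
    ≡ (c + c + 7) * (c + c + 7) + (E + 2 * (c + 3))
  identity = solve-∀
whole-numbers c E (suc x) refl refl refl refl refl eq (inj₁ le) = x , refl
  , ≤-by (2 * (c + c + 5)) (*-monoˡ-≤ (c + 2) (+-mono-≤ (≤-reflexive (sym eq)) le)) (first c E x)
  , ≤-by (c + 5) (+-mono-≤ (≤-reflexive (sym eq)) le) (second c E x)
  where
  first : ∀ c E x → (c + 5) * ((c + c + 5) * (c + 2))
    + (2 * suc x + E + (c + c + 7) + 2 * ((c + 3) * (c + 3))) * (c + 2) + 2 * (c + c + 5)
    ≡ (x * (c + 2) + 1 * (c + c + 5)) * 2 + ((c + c + 7) * (c + c + 7) + (E + (c + 3))) * (c + 2)
  first = solve-∀
  second : ∀ c E x → (c + 5) * (c + c + 5) + 0 + (2 * suc x + E + (c + c + 7) + 2 * ((c + 3) * (c + 3))) + (c + 5)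
    ≡ x * 2 + (c + 5) + ((c + c + 7) * (c + c + 7) + (E + (c + 3)))
  second = solve-∀
whole-numbers c E (suc x) refl refl refl refl refl eq (inj₂ le) = x , refl
  , ≤-by (c * c + c) (*-monoˡ-≤ (c + 2) (+-mono-≤ (≤-reflexive (sym eq)) le)) (first c E x)
  , ≤-by (2 * c) (+-mono-≤ (≤-reflexive (sym eq)) le) (second c E x)
  where
  first : ∀ c E x → (c + 5) * ((c + c + 5) * (c + 2))
    + (2 * suc x + E + (c + c + 7) + (2 * ((c + 3) * (c + 3)) + 8)) * (c + 2) + (c * c + c)
    ≡ (x * (c + 2) + 1 * (c + c + 5)) * 2 + ((c + c + 7) * (c + c + 7) + (E + 2 * (c + 3))) * (c + 2)
  first = solve-∀
  second : ∀ c E x →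
    (c + 5) * (c + c + 5) + 0 + (2 * suc x + E + (c + c + 7) + (2 * ((c + 3) * (c + 3)) + 8)) + 2 * c
    ≡ x * 2 + (c + 5) + ((c + c + 7) * (c + c + 7) + (E + 2 * (c + 3)))
  second = solve-∀

-- The bound e ≤ K² + 1 - t² is exactly what the second entry of the minimum at index `suc t`
-- demands of the whole graph; accordingly the certificate has slack 0.
whole-numbers-few : ∀ c {a K M N} E P t → a ≡ c + 5 → K ≡ c + 3 → M ≡ c + c + 5 → N ≡ c + c + 7 →
  2 * P + E + N ≡ N * N → E + 2 * (t * t) ≤ 2 * (K * K) + 2 →
  ∃ λ x → P ≡ suc x × a * M + t ^ 2 * 2 ≤ x * 2 + a
whole-numbers-few c E zero t refl refl refl refl eq le =
  ⊥-elim (1+n≰n (≤-by {1} {0} (21 + c * 14 + 2 * (c * c) + 2 * (t * t)) (+-mono-≤ (≤-reflexive (sym eq)) le)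
    (identity c E (t * t))))
  where
  identity : ∀ c E t² → 1 + (E + (c + c + 7) + (2 * ((c + 3) * (c + 3)) + 2)) + (21 + c * 14 + 2 * (c * c) + 2 * t²)
    ≡ (c + c + 7) * (c + c + 7) + (E + 2 * t²)
  identity = solve-∀
whole-numbers-few c E (suc x) t refl refl refl refl eq le = x , refl
  , ≤-by 0 (+-mono-≤ (≤-reflexive (sym eq)) le) (identity c E x t)
  where
  identity : ∀ c E x t →
    (c + 5) * (c + c + 5) + t * (t * 1) * 2 + (2 * suc x + E + (c + c + 7) + (2 * ((c + 3) * (c + 3)) + 2)) + 0
    ≡ x * 2 + (c + 5) + ((c + c + 7) * (c + c + 7) + (E + 2 * (t * t)))
  identity = solve-∀

-- The identity behind this is (k+1)(k-2) = k(k-1) - 2: a k-set missing `t` of its pairs has Q =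
-- k(k-1)/2 - t edges, so (Q-1)/(k-2) = (k+1)/2 - t/(k-2). The hypothesis `t ≤ d` keeps Q positive.
k-set-numbers : ∀ c {a d k} Q t → a ≡ c + 5 → d ≡ c + 2 → k ≡ c + 4 →
  2 * Q + 2 * t + k ≡ k * k → t ≤ d → ∃ λ x → Q ≡ suc x × a * d ≡ 2 * (x + t)
k-set-numbers c zero t refl refl refl eq t≤ =
  ⊥-elim (1+n≰n (≤-by {1} {0} (7 + c * 5 + c * c) (+-mono-≤ (≤-reflexive (sym eq)) (*-monoʳ-≤ 2 t≤)) (identity c t)))
  where
  identity : ∀ c t → 1 + (2 * t + (c + 4) + 2 * (c + 2)) + (7 + c * 5 + c * c) ≡ (c + 4) * (c + 4) + 2 * t
  identity = solve-∀
k-set-numbers c (suc x) t refl refl refl eq _ = x , refl , +-cancelʳ-≡ (c + 6) _ _ (trans (lhs c) (trans (sym eq) (rhs c x t)))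
  where
  lhs : ∀ c → (c + 5) * (c + 2) + (c + 6) ≡ (c + 4) * (c + 4)
  lhs = solve-∀
  rhs : ∀ c x t → 2 * suc x + 2 * t + (c + 4) ≡ 2 * (x + t) + (c + 6)
  rhs = solve-∀

-- Here `suc t` exceeds k - 2 and leaves the range of the maximum, but then e ≤ K² + 1 - (K-1)² =
-- 2K, which is below K² - K + 4.
few-edges⇒sparse : ∀ c {d K} E t → d ≡ c + 2 → K ≡ c + 3 → d ≤ t → E + 2 * (t * t) ≤ 2 * (K * K) + 2 →
  E + 2 * K ≤ 2 * (K * K) + 8
few-edges⇒sparse c E t refl refl d≤t le with r , refl ← m≤n⇒∃[o]m+o≡n d≤t =
  ≤-by (8 + c * 6 + 2 * (c * c) + r * 8 + 4 * (c * r) + 2 * (r * r)) le (identity c E r)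
  where
  identity : ∀ c E r → E + 2 * (c + 3) + (2 * ((c + 3) * (c + 3)) + 2)
    + (8 + c * 6 + 2 * (c * c) + r * 8 + 4 * (c * r) + 2 * (r * r))
    ≡ 2 * ((c + 3) * (c + 3)) + 8 + (E + 2 * ((c + 2 + r) * (c + 2 + r)))
  identity = solve-∀

-- Assembly of the lower bound

theorem3p5 : (k : ℕ) → 4 ≤ k → (q : ℚ) → IsM (2 * k ∸ 1) 3 q → bound k ℚ.≤ q
theorem3p5 k 4≤k q ((H , α≤2 , m2) , _) = by-cases (dichotomy (complement-triangleFree H α≤2) N≡suc[K+K])
  where
  open Counting (complement H)
  a = k + 1
  d = k ∸ 2
  K = k ∸ 1
  M = 2 * k ∸ 3
  N = 2 * k ∸ 1
  c = k ∸ 4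

  k≡ : k ≡ c + 4
  k≡ = sym (m∸n+n≡m 4≤k)

  a≡ : a ≡ c + 5
  a≡ = trans (cong (_+ 1) k≡) (+-assoc c 4 1)

  minus : ∀ {m} j r → m ≡ r + j → m ∸ j ≡ r
  minus j r eq = trans (cong (_∸ j) eq) (m+n∸n≡m r j)

  d≡ : d ≡ c + 2
  d≡ = minus 2 (c + 2) (trans k≡ (sym (+-assoc c 2 2)))

  K≡ : K ≡ c + 3
  K≡ = minus 1 (c + 3) (trans k≡ (sym (+-assoc c 3 1)))

  M≡ : M ≡ c + c + 5
  M≡ = minus 3 (c + c + 5) (trans (cong (2 *_) k≡) (identity c))
    where
    identity : ∀ c → 2 * (c + 4) ≡ c + c + 5 + 3
    identity = solve-∀

  N≡ : N ≡ c + c + 7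
  N≡ = minus 1 (c + c + 7) (trans (cong (2 *_) k≡) (identity c))
    where
    identity : ∀ c → 2 * (c + 4) ≡ c + c + 7 + 1
    identity = solve-∀

  N≡suc[K+K] : N ≡ suc (K + K)
  N≡suc[K+K] = trans N≡ (trans (identity c) (cong (λ x → suc (x + x)) (sym K≡)))
    where
    identity : ∀ c → c + c + 7 ≡ suc (c + 3 + (c + 3))
    identity = solve-∀

  suc-K≡k : suc K ≡ k
  suc-K≡k = trans (cong suc K≡) (trans (sym (+-suc c 3)) (sym k≡))

  d≥1 : 1 ≤ d
  d≥1 = subst (1 ≤_) (sym d≡) (≤-trans (s≤s z≤n) (m≤n+m 2 c))

  M≥1 : 1 ≤ M
  M≥1 = subst (1 ≤_) (sym M≡) (≤-trans (s≤s z≤n) (m≤n+m 5 (c + c)))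

  k≥3 : 3 ≤ k
  k≥3 = ≤-trans (n≤1+n 3) 4≤k

  N≥3 : 3 ≤ N
  N≥3 = subst (3 ≤_) (sym N≡) (≤-trans (s≤s (s≤s (s≤s z≤n))) (m≤n+m 7 (c + c)))

  whole : ∃ λ P → 2 * P + E + N ≡ N * N × (∀ x → P ≡ suc x → ratio (ℤ.+ x) (N ∸ 2) ℚ.≤ q)
  whole = m2-≥ H m2 𝟙 (λ _ → ≤-refl) N≥3 (sum-𝟙 N)
  P = proj₁ whole
  P-eq = proj₁ (proj₂ whole)

  P-density : ∀ x → P ≡ suc x → ratio (ℤ.+ x) M ℚ.≤ q
  P-density x P≡ = subst (λ D → ratio (ℤ.+ x) D ℚ.≤ q) (∸-+-assoc (2 * k) 1 2) (proj₂ (proj₂ whole) x P≡)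

  by-M : ∀ y s → a * M + s ≤ y * 2 + a → (a * M + s) * M ≤ y * 2 * M + a * M
  by-M y s le = subst ((a * M + s) * M ≤_) (*-distribʳ-+ M (y * 2) a) (*-monoˡ-≤ M le)

  from-sparse : E + K ≤ 2 * (K * K) ⊎ E + 2 * K ≤ 2 * (K * K) + 8 → bound k ℚ.≤ q
  from-sparse le with x , P≡ , u , w ← whole-numbers c E P a≡ d≡ K≡ M≡ N≡ P-eq le =
    -- At index 1 the square in the second entry vanishes, and the density of the whole of `H` meets
    -- both entries.
    bound-≤ k 0 d≥1 (first-loss a d 1 x M d≥1 M≥1 (P-density x P≡) u)
      (second-loss a M 0 x M M≥1 M≥1 (P-density x P≡) (by-M x 0 w))

  by-cases : Dichotomy K → bound k ℚ.≤ q
  by-cases (sparse le)  = from-sparse (inj₁ le)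
  by-cases (sparse′ le) = from-sparse (inj₂ le)
  by-cases (independent f f≤1 size f-indep)
    with Q , Q-eq , Q-density ← m2-≥ H m2 f f≤1 k≥3 (trans size suc-K≡k)
    with x , Q≡ , eq ← k-set-numbers c Q 0 a≡ d≡ k≡ (subst (λ p → 2 * Q + p + k ≡ k * k) f-indep Q-eq) z≤n
    -- The k-set is complete in `H` and has density (k+1)/2, so it meets both entries at index 1.
    = bound-≤ k 0 d≥1
        (first-loss a d 1 x d d≥1 d≥1 (Q-density x Q≡)
          (≤-by (2 * d) (≤-reflexive (cong (d *_) eq)) (first d x a)))
        (second-loss a M 0 x d M≥1 d≥1 (Q-density x Q≡)
          (≤-by (a * d) (≤-reflexive (cong (M *_) eq)) (second d x a M)))
    where
    first : ∀ d x a → a * (d * d) + d * (2 * (x + 0)) + 2 * d ≡ (x * d + 1 * d) * 2 + d * (a * d)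
    first = solve-∀
    second : ∀ d x a M → (a * M + 0 * 2) * d + M * (2 * (x + 0)) + a * d ≡ x * 2 * M + a * d + M * (a * d)
    second = solve-∀
  by-cases (few-edges t f f≤1 size f-pairs le) with suc t ≤? d
  ... | no t≮d = from-sparse (inj₂ (few-edges⇒sparse c E t d≡ K≡ (≮⇒≥ t≮d) le))
  ... | yes t<d
    with Q , Q-eq , Q-density ← m2-≥ H m2 f f≤1 k≥3 (trans size suc-K≡k)
    with x , Q≡ , eq ← k-set-numbers c Q (suc t) a≡ d≡ k≡ (subst (λ p → 2 * Q + p + k ≡ k * k) f-pairs Q-eq) t<d
    with y , P≡ , w ← whole-numbers-few c E P t a≡ K≡ M≡ N≡ P-eq le
    -- The k-set handles the first entry at index `suc t`, the whole graph the second.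
    = bound-≤ k t t<d
        (first-loss a d (suc t) x d d≥1 d≥1 (Q-density x Q≡)
          (≤-by 0 (≤-reflexive (cong (d *_) eq)) (first d x t a)))
        (second-loss a M (t ^ 2) y M M≥1 M≥1 (P-density y P≡) (by-M y (t ^ 2 * 2) w))
    where
    first : ∀ d x t a → a * (d * d) + d * (2 * (x + suc t)) + 0 ≡ (x * d + suc t * d) * 2 + d * (a * d)
    first = solve-∀
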